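{- For every constant integer $t\ge 2$, the problems $k$-DOMINATING SET, $k$-CONNECTED DOMINATING SET, $k$-INDEPENDENT DOMINATING SET, and $k$-DOMINATING CLIQUE, each restricted to $t$-interval graphs and each restricted to co-$t$-interval graphs (complements of $t$-interval graphs), with parameter $k$, are in W[1].
   Context: A dominating set of a graph $H$ is a set $D$ of vertices such that every vertex of $H$ is in $D$ or adjacent to a vertex of $D$. A connected dominating set is a dominating set inducing a connected subgraph; an independent dominating set is a dominating set that is also an independent set; a dominating clique is a dominating set that is also a clique. Each of the four problems asks, given a graph $H$ and an integer $k$, whether $H$ has a set of $k$ vertices of the corresponding type. The intersection graph of a family of sets has one vertex per member, two different members being adjacent iff they intersect; the family is a representation of the graph. A $t$-interval is the union of $t$ disjoint intervals in the real line. A $t$-interval graph is the intersection graph of a family of $t$-intervals, and a co-$t$-interval graph is the complement of a $t$-interval graph. A multiple-interval representation (of $H$, resp. of the complement of $H$) is given as part of the input. W[1] is the class of parameterized problems that have an FPT reduction to $k$-CLIQUE in general graphs (parameter $k$); equivalently, to SHORT TURING MACHINE COMPUTATION (given a nondeterministic Turing machine $M$ and an integer $k$, decide whether $M$ accepts the empty string within $k$ steps; parameter $k$). An FPT reduction maps an instance $(x,k)$ to an equivalent instance $(x',k')$ in time $g(k)\cdot|x|^{O(1)}$ with $k'\le h(k)$, for computable functions $g,h$. -}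

module Defs where

open import Data.Bool.Base using (Bool; true; false; T)
open import Data.Fin.Base using (Fin)
open import Data.Fin.Properties using (_≟_; any?)
open import Data.Fin.Subset using (Subset; _∈_; ∣_∣)
open import Data.Integer.Base as ℤ using (ℤ; +_; -[1+_])
open import Data.List.Base using (List; []; _∷_; tabulate)
open import Data.Nat.Base using (ℕ; zero; suc; _+_; _*_; _^_; _≤_)
open import Data.Nat.Binary.Base using (ℕᵇ; zero; 2[1+_]; 1+[2_]; fromℕ)
open import Data.Product.Base using (Σ-syntax; ∃; ∃-syntax; _×_; _,_)
open import Data.Rational.Base as ℚ using (ℚ)
import Data.Rational.Properties as ℚ
open import Data.Rational.Literals using (fromℤ)
open import Data.Sum.Base using (_⊎_)
open import Function.Base using (_∘_)
open import Function.Bundles using (_⇔_; mk⇔)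
open import Level using (0ℓ)
open import Relation.Binary.Construct.Closure.ReflexiveTransitive using (Star)
open import Relation.Binary.Core using (Rel)
open import Relation.Binary.Definitions using (Decidable; Symmetric; Irreflexive)
open import Relation.Binary.PropositionalEquality using (_≡_; _≢_; refl; sym; subst)
open import Relation.Nullary using (¬_; Dec; does)
open import Relation.Nullary.Decidable
  using (map′; ¬?; _×-dec_; T?; dec-false; does-⇔)

------------------------------------------------------------------------
-- Computation

-- The data are binary trees; `leaf` doubles as false / the empty list.

data Tree : Set where
  leaf : Tree
  node : Tree → Tree → Tree

size : Tree → ℕ
size leaf       = 1
size (node l r) = 1 + size l + size r

-- Deterministic WHILE programs over binary trees (the language WHILE of
-- N. D. Jones, "Computability and Complexity"), in point-free form: the
-- store is a single tree, and every program is a transformer of it.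

infixr 5 _⨾_

data Prog : Set where
  skip nil hd tl : Prog
  _⨾_            : Prog → Prog → Prog          -- left to right
  pair           : Prog → Prog → Prog
  ifte           : Prog → Prog → Prog → Prog
  while          : Prog → Prog → Prog

-- `Run p x y c`: on x, the program p halts with result y after time c.
-- Building a pair is charged the full size of the tree it yields, so that
-- every tree occurring in a run has size at most input size + time. Without
-- this charge, repeated doubling would build trees of exponential size in
-- linear time; with it, the time is polynomially related to the time of a
-- Turing machine.

data Run : Prog → Tree → Tree → ℕ → Set where
  skip⇓   : ∀ {x} → Run skip x x 1
  nil⇓    : ∀ {x} → Run nil x leaf 1
  hd-leaf : Run hd leaf leaf 1
  hd-node : ∀ {x y} → Run hd (node x y) x 1
  tl-leaf : Run tl leaf leaf 1
  tl-node : ∀ {x y} → Run tl (node x y) y 1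
  seq⇓    : ∀ {p q x y z c d} →
            Run p x y c → Run q y z d → Run (p ⨾ q) x z (c + d)
  pair⇓   : ∀ {p q x y z c d} →
            Run p x y c → Run q x z d →
            Run (pair p q) x (node y z) (c + d + size (node y z))
  if-node : ∀ {b p q x l r y c d} →
            Run b x (node l r) c → Run p x y d → Run (ifte b p q) x y (1 + c + d)
  if-leaf : ∀ {b p q x y c d} →
            Run b x leaf c → Run q x y d → Run (ifte b p q) x y (1 + c + d)
  while-leaf : ∀ {b p x c} →
            Run b x leaf c → Run (while b p) x x (1 + c)
  while-node : ∀ {b p x l r y z c d e} →
            Run b x (node l r) c → Run p x y d → Run (while b p) y z e →
            Run (while b p) x z (1 + c + d + e)

------------------------------------------------------------------------
-- Encodings

encBool : Bool → Tree
encBool false = leaf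
encBool true  = node leaf leaf

encList : {A : Set} → (A → Tree) → List A → Tree
encList enc []       = leaf
encList enc (x ∷ xs) = node (enc x) (encList enc xs)

encFamily : {A : Set} {n : ℕ} → (A → Tree) → (Fin n → A) → Tree
encFamily enc = encList enc ∘ tabulate

-- Unary; used only for parameters.

encParam : ℕ → Tree
encParam zero    = leaf
encParam (suc k) = node leaf (encParam k)

-- Integers are written in (bijective) binary, least significant digit first.

encℕᵇ : ℕᵇ → Tree
encℕᵇ zero     = leaf
encℕᵇ 2[1+ x ] = node (encBool false) (encℕᵇ x)
encℕᵇ 1+[2 x ] = node (encBool true) (encℕᵇ x)

encℤ : ℤ → Tree
encℤ (+ n)    = node (encBool false) (encℕᵇ (fromℕ n))
encℤ -[1+ n ] = node (encBool true) (encℕᵇ (fromℕ n))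

------------------------------------------------------------------------
-- Parameterized problems, FPT reductions, W[1]

record ParamProblem : Set₁ where
  field
    Instance : Set
    encode   : Instance → Tree
    Yes      : Instance → ℕ → Set

Computable : (ℕ → ℕ) → Set
Computable f =
  Σ[ p ∈ Prog ] ∀ k → ∃[ c ] Run p (encParam k) (encParam (f k)) c

record FPTReduction (P Q : ParamProblem) : Set where
  private
    module P = ParamProblem P
    module Q = ParamProblem Q
  field
    g h          : ℕ → ℕ
    g-computable : Computable g
    h-computable : Computable h
    exponent     : ℕ
    program      : Prog
    reduces      : ∀ x k → Σ[ x′ ∈ Q.Instance ] ∃[ k′ ] ∃[ time ]
      Run program (node (P.encode x) (encParam k))
                  (node (Q.encode x′) (encParam k′)) time
      × time ≤ g k * size (P.encode x) ^ exponent
      × k′ ≤ h k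
      × (P.Yes x k ⇔ Q.Yes x′ k′)

------------------------------------------------------------------------
-- Finite simple graphs

record Graph (n : ℕ) : Set where
  field
    adj        : Fin n → Fin n → Bool
    adj-sym    : ∀ u v → adj u v ≡ adj v u
    adj-irrefl : ∀ u → adj u u ≡ false

  infix 4 _~_
  _~_ : Rel (Fin n) 0ℓ
  u ~ v = T (adj u v)

fromRelation : ∀ {n} {R : Rel (Fin n) 0ℓ} →
               Decidable R → Symmetric R → Irreflexive _≡_ R → Graph n
fromRelation R? R-sym R-irrefl = record
  { adj        = λ u v → does (R? u v)
  ; adj-sym    = λ u v → does-⇔ (mk⇔ R-sym R-sym) (R? u v) (R? v u)
  ; adj-irrefl = λ u → dec-false (R? u u) (R-irrefl refl)
  }

complement : ∀ {n} → Graph n → Graph n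
complement {n} G = fromRelation {R = λ u v → u ≢ v × ¬ (u ~ v)}
  (λ u v → ¬? (u ≟ v) ×-dec ¬? (T? (adj u v)))
  (λ { {u} {v} (u≢v , u≁v) → u≢v ∘ sym , u≁v ∘ subst T (adj-sym v u) })
  (λ { u≡v (u≢v , _) → u≢v u≡v })
  where open Graph G

VertexSetProperty : Set₁
VertexSetProperty = ∀ {n} → Graph n → Subset n → Set

module _ {n : ℕ} (G : Graph n) (D : Subset n) where
  open Graph G

  IsDominating : Set
  IsDominating = ∀ v → v ∈ D ⊎ (∃[ u ] u ∈ D × v ~ u)

  -- Any two vertices of D are joined by a path inside D.
  InducesConnected : Set
  InducesConnected = ∀ {u v} → u ∈ D → v ∈ D →
    Star (λ x y → x ∈ D × y ∈ D × x ~ y) u v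

  IsIndependent : Set
  IsIndependent = ∀ {u v} → u ∈ D → v ∈ D → ¬ (u ~ v)

  IsClique : Set
  IsClique = ∀ {u v} → u ∈ D → v ∈ D → u ≢ v → u ~ v

IsConnectedDominating : VertexSetProperty
IsConnectedDominating G D = IsDominating G D × InducesConnected G D

IsIndependentDominating : VertexSetProperty
IsIndependentDominating G D = IsDominating G D × IsIndependent G D

IsDominatingClique : VertexSetProperty
IsDominatingClique G D = IsDominating G D × IsClique G D

HasSetOfSize : VertexSetProperty → ∀ {n} → Graph n → ℕ → Set
HasSetOfSize Property G k = ∃[ D ] ∣ D ∣ ≡ k × Property G D

-- General graphs, given by their adjacency matrices.

k-CLIQUE : ParamProblem
k-CLIQUE = record
  { Instance = ∃ Graph
  ; encode   = λ (_ , G) → encFamily (encFamily encBool) (Graph.adj G)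
  ; Yes      = λ (_ , G) k → HasSetOfSize IsClique G k
  }

infix 4 _∈W[1]

_∈W[1] : ParamProblem → Set
P ∈W[1] = FPTReduction P k-CLIQUE

------------------------------------------------------------------------
-- Multiple intervals

-- Closed intervals with integer endpoints, as sets of points of the rational
-- line. Since the input is finite, some finite format for the endpoints is
-- needed; replacing the endpoints of a finite family of real intervals (open,
-- closed or half-open) by suitable integers in the same order changes neither
-- which of them intersect nor which are disjoint.

record Interval : Set where
  field
    lo hi : ℤ
    lo≤hi : lo ℤ.≤ hi

_∈ᴵ_ : ℚ → Interval → Set
q ∈ᴵ I = fromℤ lo ℚ.≤ q × q ℚ.≤ fromℤ hi
  where open Interval I

record MultiInterval (t : ℕ) : Set where
  field
    interval : Fin t → Interval
    disjoint : ∀ {i j} → i ≢ j → ∀ q → q ∈ᴵ interval i → ¬ (q ∈ᴵ interval j)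

_∈ᴹ_ : ∀ {t} → ℚ → MultiInterval t → Set
q ∈ᴹ M = ∃[ i ] q ∈ᴵ MultiInterval.interval M i

Intersect : ∀ {t} → Rel (MultiInterval t) 0ℓ
Intersect M N = ∃[ q ] q ∈ᴹ M × q ∈ᴹ N

intersectᴵ? : ∀ I J → Dec (∃[ q ] q ∈ᴵ I × q ∈ᴵ J)
intersectᴵ? I J = map′
  (λ (l≤h′ , l′≤h) → fromℤ I.lo ℚ.⊔ fromℤ J.lo ,
    (ℚ.p≤p⊔q _ _ , ℚ.⊔-lub (fromℤ-mono I.lo≤hi) l′≤h) ,
    (ℚ.p≤q⊔p _ _ , ℚ.⊔-lub l≤h′ (fromℤ-mono J.lo≤hi)))
  (λ (_ , (l≤q , q≤h) , (l′≤q , q≤h′)) →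
    ℚ.≤-trans l≤q q≤h′ , ℚ.≤-trans l′≤q q≤h)
  ((fromℤ I.lo ℚ.≤? fromℤ J.hi) ×-dec (fromℤ J.lo ℚ.≤? fromℤ I.hi))
  where
  module I = Interval I
  module J = Interval J
  fromℤ-mono : ∀ {a b} → a ℤ.≤ b → fromℤ a ℚ.≤ fromℤ b
  fromℤ-mono a≤b = ℚ.*≤* (ℤ.*-monoʳ-≤-nonNeg (+ 1) a≤b)
    where import Data.Integer.Properties as ℤ

intersect? : ∀ {t} → Decidable (Intersect {t})
intersect? M N = map′
  (λ (i , j , q , q∈I , q∈J) → q , (i , q∈I) , (j , q∈J))
  (λ (q , (i , q∈I) , (j , q∈J)) → i , j , q , q∈I , q∈J)
  (any? λ i → any? λ j →
    intersectᴵ? (MultiInterval.interval M i) (MultiInterval.interval N j))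

------------------------------------------------------------------------
-- Multiple-interval graphs

Representation : ℕ → ℕ → Set
Representation t n = Fin n → MultiInterval t

intersectionGraph : ∀ {t n} → Representation t n → Graph n
intersectionGraph F = fromRelation {R = λ u v → u ≢ v × Intersect (F u) (F v)}
  (λ u v → ¬? (u ≟ v) ×-dec intersect? (F u) (F v))
  (λ (u≢v , q , q∈Fu , q∈Fv) → u≢v ∘ sym , q , q∈Fv , q∈Fu)
  (λ { u≡v (u≢v , _) → u≢v u≡v })

encInterval : Interval → Tree
encInterval I = node (encℤ (Interval.lo I)) (encℤ (Interval.hi I))

encRepresentation : ∀ {t n} → Representation t n → Tree
encRepresentation = encFamily (encFamily encInterval ∘ MultiInterval.interval)

-- The input graph is presented by the representation of itself, respectively
-- of its complement.

_onIntervalGraphs_ : VertexSetProperty → ℕ → ParamProblem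
Property onIntervalGraphs t = record
  { Instance = ∃ (Representation t)
  ; encode   = λ (_ , F) → encRepresentation F
  ; Yes      = λ (_ , F) k → HasSetOfSize Property (intersectionGraph F) k
  }

_onCoIntervalGraphs_ : VertexSetProperty → ℕ → ParamProblem
Property onCoIntervalGraphs t = record
  { Instance = ∃ (Representation t)
  ; encode   = λ (_ , F) → encRepresentation F
  ; Yes      = λ (_ , F) k →
      HasSetOfSize Property (complement (intersectionGraph F)) k
  }

infix 5 _onIntervalGraphs_ _onCoIntervalGraphs_

{-# OPTIONS --safe #-}
module Submission where

-- Represent a set of k vertices by an injective list d. Whether a vertex v is
-- dominated by d j depends only on finitely many comparisons of endpoints of v
-- with endpoints of d j (and of v with d j itself). For each of these m
-- comparisons, the values coming from d cut the line into cells, and v is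
-- described by the m-tuple of cells containing it; all vertices with the same
-- cells are dominated by the same d j. Each m-tuple of cells is identified by
-- the indices of the lower ends, which leaves at most (k + 1)^m tuples. For
-- each tuple we guess the upper ends and a dominating j, and check the guess
-- against all vertices of the input. A wrong upper end does no harm: any
-- threshold of d above the lower end bounds a region that includes the cell.
--
-- The guesses for the tuples are the vertices of the clique instance; two of
-- them are joined if they belong to different tuples and agree about d. Two
-- further indices in the tuple serve to check independence, adjacency, or
-- connectedness, the latter in the form that every d b but the last has a
-- neighbour d c with b < c. The whole construction runs in time polynomial in
-- the input size and k, with an exponent depending on t only.

open import Defs
open import Data.Bool.Base using (Bool; true; false; T; not; _∧_; _∨_; if_then_else_)
open import Data.Bool.ListAction using (all)
open import Data.Bool.Properties using (T?; T-≡; T-∨; ¬-not; ∧-assoc; ∧-comm)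
open import Data.Empty using (⊥; ⊥-elim)
open import Data.Fin.Base as Fin using (Fin; zero; suc; toℕ; combine)
open import Data.Fin.Induction using (>-wellFounded)
open import Data.Fin.Properties
  using (_≟_; any?; all?; injective⇒≤; combine-injective; combine-surjective; suc-injective;
         toℕ-injective; toℕ<n; ≤fromℕ; ≤∧≢⇒<)
open import Data.Fin.Subset using (Subset; _∈_; ∣_∣)
open import Data.Integer.Base as ℤ using (ℤ; -[1+_])
import Data.Integer.Properties as ℤ
open import Data.List.Base as List
  using (List; []; _∷_; [_]; _ʳ++_; concatMap; length; drop; null; filterᵇ; replicate;
         tabulate; allFin; lookup)
open import Data.List.Membership.Propositional using () renaming (_∈_ to _∈ˡ_)
open import Data.List.Membership.Propositional.Properties
  using (∈-lookup; ∈-map⁺; ∈-concatMap⁺; ∈-filter⁺; ∈-filter⁻; ∈-allFin)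
open import Data.List.Properties
  using (++-ʳ++; reverse-involutive; length-++; length-ʳ++; length-replicate; length-tabulate;
         map-tabulate)
open import Data.List.Relation.Unary.All as All using (All; []; _∷_)
open import Data.List.Relation.Unary.All.Properties using (all⁺; all⁻)
open import Data.List.Relation.Unary.Any as Any using (index; here; there)
open import Data.List.Relation.Unary.Any.Properties using (lookup-index)
open import Data.Maybe.Base using (Maybe; just; nothing; maybe)
open import Data.Nat.Base
open import Data.Nat.Binary.Base as ℕᵇ using (ℕᵇ; zero; 2[1+_]; 1+[2_]; fromℕ)
import Data.Nat.Binary.Properties as ℕᵇ
import Data.Nat.Properties as ℕ
open import Data.Nat.Properties
  using (*-distribʳ-+; *-identityʳ; *-mono-≤; *-monoʳ-≤; *-monoˡ-≤; +-assoc; +-comm; +-mono-≤;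
         +-monoʳ-≤; +-monoˡ-≤; +-suc; <⇒≤; [m*n]*[o*p]≡[m*o]*[n*p]; ^-distribˡ-+-*; ^-monoʳ-≤;
         m≤m+n; m≤n+m; m≤n⇒m<n∨m≡n; n≤1+n; ≤-refl; ≤-reflexive; ≤-trans)
open import Data.Nat.Solver using (module +-*-Solver)
open import Data.Product.Base using (Σ-syntax; ∃; ∃-syntax; _×_; _,_; proj₁; proj₂)
open import Data.Rational.Base as ℚ using (ℚ)
open import Data.Rational.Literals using (fromℤ)
import Data.Rational.Properties as ℚ
open import Data.Sum.Base as Sum using (_⊎_; inj₁; inj₂; [_,_]′)
open import Data.Unit.Base using (⊤; tt)
open import Data.Vec.Base as Vec using (Vec; []; _∷_; here; there)
import Data.Vec.Functional as F
import Data.Vec.Properties as Vec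
open import Function.Base using (_∘_; id)
open import Function.Bundles using (_⇔_; mk⇔; Equivalence)
open import Function.Definitions using (Injective)
open import Induction.WellFounded using (Acc; acc)
open import Relation.Binary.Construct.Closure.ReflexiveTransitive as Star using (Star; ε; _◅_; _◅◅_)
open import Relation.Binary.PropositionalEquality
  using (_≡_; _≢_; refl; sym; trans; cong; cong₂; subst; subst₂; module ≡-Reasoning)
open import Relation.Nullary using (¬_; Dec; yes; no; does; contradiction)
open import Relation.Nullary.Decidable
  using (¬?; dec-true; dec-false; decidable-stable; _×-dec_)

open Equivalence using (to; from)

-- The obstacle is the shape of domination: it quantifies over all vertices of the input, whereas a
-- clique whose size depends on k alone provides boundedly many guesses that are compared two at a
-- time. So the universal quantifier is moved into the construction of the graph, where each single
-- guess is checked against the whole input. No vertex of the clique instance stands for the set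
-- itself. Wherever a guess mentions an index it also names the vertex supposed to have that index,
-- and the pairwise condition "equal indices iff equal vertices" makes these scattered pairs one
-- injective function d. The tuples have to be fixed before d is known, hence before the order of
-- its thresholds is known. This is why a cell is named by the index of its lower end and not by its
-- rank, and why its upper end, the successor in the unknown order, has to be guessed. Tuples whose
-- region contains no vertex do occur; for these the guess may name no dominating vertex. Since a
-- reduction has to be an actual WHILE program, every function used in it is built together with a
-- program and a polynomial time bound.

infixl 6 _⊕_
infixl 7 _⊗_

-- Syntax rather than functions, because a time bound is not only evaluated: it is composed with
-- others, has an exponent read off it, and is itself computed by a program.
data Poly : Set where
  const   : ℕ → Poly
  var     : Poly
  _⊕_ _⊗_ : Poly → Poly → Poly

⟦_⟧ : Poly → ℕ → ℕ
⟦ const c ⟧ n = c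
⟦ var ⟧     n = n
⟦ p ⊕ q ⟧   n = ⟦ p ⟧ n + ⟦ q ⟧ n
⟦ p ⊗ q ⟧   n = ⟦ p ⟧ n * ⟦ q ⟧ n

⟦⟧-mono : ∀ p {m n} → m ≤ n → ⟦ p ⟧ m ≤ ⟦ p ⟧ n
⟦⟧-mono (const c) m≤n = ≤-refl
⟦⟧-mono var       m≤n = m≤n
⟦⟧-mono (p ⊕ q)   m≤n = +-mono-≤ (⟦⟧-mono p m≤n) (⟦⟧-mono q m≤n)
⟦⟧-mono (p ⊗ q)   m≤n = *-mono-≤ (⟦⟧-mono p m≤n) (⟦⟧-mono q m≤n)

infixl 8 _after_

_after_ : Poly → Poly → Poly
const c after r = const c
var     after r = r
(p ⊕ q) after r = p after r ⊕ q after r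
(p ⊗ q) after r = (p after r) ⊗ (q after r)

⟦after⟧ : ∀ p r n → ⟦ p after r ⟧ n ≡ ⟦ p ⟧ (⟦ r ⟧ n)
⟦after⟧ (const c) r n = refl
⟦after⟧ var       r n = refl
⟦after⟧ (p ⊕ q)   r n = cong₂ _+_ (⟦after⟧ p r n) (⟦after⟧ q r n)
⟦after⟧ (p ⊗ q)   r n = cong₂ _*_ (⟦after⟧ p r n) (⟦after⟧ q r n)

-- Only an upper bound for the degree: adding also at `⊕` avoids maxima, and all that matters is
-- that some exponent exists.
degree : Poly → ℕ
degree (const c) = 0
degree var       = 1
degree (p ⊕ q)   = degree p + degree q
degree (p ⊗ q)   = degree p + degree q

-- Separates the parameter from the input size in a time bound.
⟦⟧-separate : ∀ p a b .{{_ : NonZero b}} → ⟦ p ⟧ (a * b) ≤ ⟦ p ⟧ a * b ^ degree p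
⟦⟧-separate (const c) a b = ≤-reflexive (sym (*-identityʳ c))
⟦⟧-separate var a b = ≤-reflexive (cong (a *_) (sym (*-identityʳ b)))
⟦⟧-separate (p ⊕ q) a b = begin
  ⟦ p ⟧ (a * b) + ⟦ q ⟧ (a * b)
    ≤⟨ +-mono-≤ (⟦⟧-separate p a b) (⟦⟧-separate q a b) ⟩
  ⟦ p ⟧ a * b ^ degree p + ⟦ q ⟧ a * b ^ degree q
    ≤⟨ +-mono-≤ (*-monoʳ-≤ (⟦ p ⟧ a) (^-monoʳ-≤ b (m≤m+n (degree p) (degree q))))
                (*-monoʳ-≤ (⟦ q ⟧ a) (^-monoʳ-≤ b (m≤n+m (degree q) (degree p)))) ⟩
  ⟦ p ⟧ a * b ^ degree (p ⊕ q) + ⟦ q ⟧ a * b ^ degree (p ⊕ q)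
    ≡⟨ *-distribʳ-+ (b ^ degree (p ⊕ q)) (⟦ p ⟧ a) (⟦ q ⟧ a) ⟨
  (⟦ p ⟧ a + ⟦ q ⟧ a) * b ^ degree (p ⊕ q) ∎
  where open ℕ.≤-Reasoning
⟦⟧-separate (p ⊗ q) a b = begin
  ⟦ p ⟧ (a * b) * ⟦ q ⟧ (a * b)
    ≤⟨ *-mono-≤ (⟦⟧-separate p a b) (⟦⟧-separate q a b) ⟩
  (⟦ p ⟧ a * b ^ degree p) * (⟦ q ⟧ a * b ^ degree q)
    ≡⟨ [m*n]*[o*p]≡[m*o]*[n*p] (⟦ p ⟧ a) _ _ _ ⟩
  (⟦ p ⟧ a * ⟦ q ⟧ a) * (b ^ degree p * b ^ degree q)
    ≡⟨ cong (⟦ p ⟧ a * ⟦ q ⟧ a *_) (^-distribˡ-+-* b (degree p) (degree q)) ⟨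
  (⟦ p ⟧ a * ⟦ q ⟧ a) * b ^ degree (p ⊗ q) ∎
  where open ℕ.≤-Reasoning

-- Programs with polynomial time bounds

Within : Prog → Tree → Tree → ℕ → Set
Within p x y b = ∃[ c ] Run p x y c × c ≤ b

-- Pairing, the only step that enlarges a tree, is charged the size of its result. This lets time
-- bounds compose, since the time of a second program is measured in the output of the first.
size-output : ∀ {p x y c} → Run p x y c → size y ≤ size x + c
size-output skip⇓   = m≤m+n _ _
size-output nil⇓    = m≤n+m _ _
size-output hd-leaf = s≤s z≤n
size-output (hd-node {x} {y}) = begin
  size x               ≤⟨ m≤m+n (size x) (size y) ⟩
  size x + size y      ≤⟨ n≤1+n _ ⟩
  size (node x y)      ≤⟨ m≤m+n _ 1 ⟩
  size (node x y) + 1  ∎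
  where open ℕ.≤-Reasoning
size-output tl-leaf = s≤s z≤n
size-output (tl-node {x} {y}) = begin
  size y               ≤⟨ m≤n+m (size y) (size x) ⟩
  size x + size y      ≤⟨ n≤1+n _ ⟩
  size (node x y)      ≤⟨ m≤m+n _ 1 ⟩
  size (node x y) + 1  ∎
  where open ℕ.≤-Reasoning
size-output (seq⇓ {x = x} {c = c} r s) =
  ≤-trans (size-output s) (≤-trans (+-monoˡ-≤ _ (size-output r)) (≤-reflexive (+-assoc (size x) c _)))
size-output (pair⇓ {x = x} {c = c} {d} r s) =
  ≤-trans (m≤n+m _ (c + d)) (m≤n+m (c + d + _) (size x))
size-output (if-node {x = x} {c = c} {d} r s) =
  ≤-trans (size-output s) (+-monoʳ-≤ (size x) (m≤n+m d (1 + c)))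
size-output (if-leaf {x = x} {c = c} {d} r s) =
  ≤-trans (size-output s) (+-monoʳ-≤ (size x) (m≤n+m d (1 + c)))
size-output (while-leaf r) = m≤m+n _ _
size-output (while-node {x = x} {c = c} {d} {e} r s u) = begin
  _                          ≤⟨ size-output u ⟩
  _                          ≤⟨ +-monoˡ-≤ e (size-output s) ⟩
  size x + d + e             ≡⟨ +-assoc (size x) d e ⟩
  size x + (d + e)           ≤⟨ +-monoʳ-≤ (size x) (m≤n+m (d + e) (1 + c)) ⟩
  size x + (1 + c + (d + e)) ≡⟨ cong (size x +_) (+-assoc (1 + c) d e) ⟨
  size x + (1 + c + d + e)   ∎
  where open ℕ.≤-Reasoning

within-output : ∀ {p x y b} → Within p x y b → size y ≤ size x + b
within-output (c , r , c≤b) = ≤-trans (size-output r) (+-monoʳ-≤ _ c≤b)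

size≥1 : ∀ x → 1 ≤ size x
size≥1 leaf       = s≤s z≤n
size≥1 (node l r) = s≤s z≤n

-- Types indexed by problem instances: the data may mention the instance, and
-- a single program must work for all instances.

record Ty (I : Set) : Set₁ where
  no-eta-equality
  field
    Carrier : I → Set
    enc     : ∀ i → Carrier i → Tree

open Ty

variable
  I : Set
  Γ A B C D : Ty I

infix 4 _⟶_

-- The reduction is composed of such arrows, so that program and time bound arise along with the
-- function, and correctness can be argued about `fun` alone.
record _⟶_ {I : Set} (A B : Ty I) : Set where
  no-eta-equality
  field
    fun  : ∀ i → Carrier A i → Carrier B i
    prog : Prog
    cost : Poly
    runs : ∀ i x → Within prog (enc A i x) (enc B i (fun i x)) (⟦ cost ⟧ (size (enc A i x)))

  growth : Poly
  growth = var ⊕ cost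

  size-fun : ∀ i x → size (enc B i (fun i x)) ≤ ⟦ growth ⟧ (size (enc A i x))
  size-fun i x = within-output (runs i x)

open _⟶_

infixr 5 _×ᵗ_

_×ᵗ_ : Ty I → Ty I → Ty I
(A ×ᵗ B) .Carrier i = Carrier A i × Carrier B i
(A ×ᵗ B) .enc i (x , y) = node (enc A i x) (enc B i y)

unit bool nat : Ty I
unit .Carrier _ = ⊤
unit .enc _ _   = leaf
bool .Carrier _ = Bool
bool .enc _     = encBool
nat .Carrier _  = ℕ
nat .enc _      = encParam

list maybeᵗ : Ty I → Ty I
list A .Carrier i = List (Carrier A i)
list A .enc i     = encList (enc A i)
maybeᵗ A .Carrier i        = Maybe (Carrier A i)
maybeᵗ A .enc i nothing    = leaf
maybeᵗ A .enc i (just x)   = node leaf (enc A i x)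

-- Programs see encodings only, so two functions whose values have the same encodings share a
-- program, even across different types.
recode : (f : A ⟶ B) (g : ∀ i → Carrier A i → Carrier C i) →
         (∀ i x → enc C i (g i x) ≡ enc B i (fun f i x)) → A ⟶ C
recode f g eq .fun  = g
recode f g eq .prog = prog f
recode f g eq .cost = cost f
recode {A = A} f g eq .runs i x =
  subst (λ y → Within (prog f) (enc A i x) y (⟦ cost f ⟧ (size (enc A i x))))
        (sym (eq i x)) (runs f i x)

extensional : (f : A ⟶ B) (g : ∀ i → Carrier A i → Carrier B i) →
              (∀ i x → fun f i x ≡ g i x) → A ⟶ B
extensional {B = B} f g eq = recode f g λ i x → cong (enc B i) (sym (eq i x))

idᵗ : A ⟶ A
idᵗ .fun i x  = x
idᵗ .prog     = skip
idᵗ .cost     = const 1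
idᵗ .runs i x = 1 , skip⇓ , ≤-refl

retype : (g : ∀ i → Carrier A i → Carrier B i) →
         (∀ i x → enc B i (g i x) ≡ enc A i x) → A ⟶ B
retype = recode idᵗ

build : Tree → Prog
build leaf       = nil
build (node l r) = pair (build l) (build r)

buildCost : Tree → ℕ
buildCost leaf       = 1
buildCost (node l r) = buildCost l + buildCost r + size (node l r)

build-runs : ∀ x t → Run (build t) x t (buildCost t)
build-runs x leaf       = nil⇓
build-runs x (node l r) = pair⇓ (build-runs x l) (build-runs x r)

constant : ∀ t (g : ∀ i → Carrier B i) → (∀ i → enc B i (g i) ≡ t) → A ⟶ B
constant t g eq .fun i _ = g i
constant t g eq .prog    = build t
constant t g eq .cost    = const (buildCost t)
constant {A = A} t g eq .runs i x =
  _ , subst (λ y → Run (build t) (enc A i x) y (buildCost t)) (sym (eq i))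
        (build-runs (enc A i x) t) , ≤-refl

infixr 4 _⨟_

_⨟_ : A ⟶ B → B ⟶ C → A ⟶ C
(f ⨟ g) .fun i x = fun g i (fun f i x)
(f ⨟ g) .prog = prog f ⨾ prog g
(f ⨟ g) .cost = cost f ⊕ cost g after growth f
_⨟_ {A = A} f g .runs i x =
  let s          = size (enc A i x)
      c , r , c≤ = runs f i x
      d , t , d≤ = runs g i (fun f i x)
  in c + d , seq⇓ r t , +-mono-≤ c≤ (≤-trans d≤ (≤-trans
       (⟦⟧-mono (cost g) (size-fun f i x))
       (≤-reflexive (sym (⟦after⟧ (cost g) (growth f) s)))))

⟨_,_⟩ : Γ ⟶ A → Γ ⟶ B → Γ ⟶ A ×ᵗ B
⟨ f , g ⟩ .fun i x = fun f i x , fun g i x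
⟨ f , g ⟩ .prog = pair (prog f) (prog g)
⟨ f , g ⟩ .cost = cost f ⊕ cost g ⊕ (const 1 ⊕ growth f ⊕ growth g)
⟨ f , g ⟩ .runs i x =
  let c , r , c≤ = runs f i x
      d , t , d≤ = runs g i x
  in _ , pair⇓ r t ,
     +-mono-≤ (+-mono-≤ c≤ d≤) (+-mono-≤ (s≤s (size-fun f i x)) (size-fun g i x))

fst : A ×ᵗ B ⟶ A
fst .fun i     = proj₁
fst .prog      = hd
fst .cost      = const 1
fst .runs i x  = 1 , hd-node , ≤-refl

snd : A ×ᵗ B ⟶ B
snd .fun i     = proj₂
snd .prog      = tl
snd .cost      = const 1
snd .runs i x  = 1 , tl-node , ≤-refl

ifᵗ : Γ ⟶ bool → Γ ⟶ A → Γ ⟶ A → Γ ⟶ A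
ifᵗ b f g .fun i x = if fun b i x then fun f i x else fun g i x
ifᵗ b f g .prog = ifte (prog b) (prog f) (prog g)
ifᵗ b f g .cost = const 1 ⊕ cost b ⊕ (cost f ⊕ cost g)
ifᵗ b f g .runs i x with fun b i x | runs b i x
... | true  | c , r , c≤ =
  let d , t , d≤ = runs f i x
  in _ , if-node r t , +-mono-≤ (s≤s c≤) (≤-trans d≤ (m≤m+n _ _))
... | false | c , r , c≤ =
  let d , t , d≤ = runs g i x
  in _ , if-leaf r t , +-mono-≤ (s≤s c≤) (≤-trans d≤ (m≤n+m _ _))

caseMaybe : Γ ⟶ B → Γ ×ᵗ A ⟶ B → Γ ×ᵗ maybeᵗ A ⟶ B
caseMaybe n j .fun i (γ , m) = maybe (λ x → fun j i (γ , x)) (fun n i γ) m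
caseMaybe n j .prog = ifte tl (pair hd (tl ⨾ tl) ⨾ prog j) (hd ⨾ prog n)
caseMaybe n j .cost = const 5 ⊕ var ⊕ cost j ⊕ cost n
caseMaybe {Γ = Γ} {A = A} n j .runs i (γ , nothing) =
  let d , t , d≤ = runs n i γ
      γ≤ = ≤-trans (m≤m+n (size (enc Γ i γ)) 1) (n≤1+n _)
  in _ , if-leaf tl-node (seq⇓ hd-node t) ,
     (begin
       3 + d ≤⟨ +-mono-≤ (s≤s (s≤s (s≤s (z≤n {2 + S + ⟦ cost j ⟧ S})))) (≤-trans d≤ (⟦⟧-mono (cost n) γ≤)) ⟩
       _ ∎)
  where
  open ℕ.≤-Reasoning
  S = size (enc (Γ ×ᵗ maybeᵗ A) i (γ , nothing))
caseMaybe {Γ = Γ} {A = A} n j .runs i (γ , just x) =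
  let d , t , d≤ = runs j i (γ , x)
  in _ , if-node tl-node (seq⇓ (pair⇓ hd-node (seq⇓ tl-node tl-node)) t) ,
     (begin
       2 + (3 + P + d)
         ≤⟨ +-monoʳ-≤ 5 (+-mono-≤ P≤S (≤-trans d≤ (⟦⟧-mono (cost j) P≤S))) ⟩
       5 + (S + ⟦ cost j ⟧ S)
         ≡⟨⟩
       5 + S + ⟦ cost j ⟧ S
         ≤⟨ m≤m+n _ _ ⟩
       _ ∎)
  where
  open ℕ.≤-Reasoning
  P = size (enc (Γ ×ᵗ A) i (γ , x))
  S = size (enc (Γ ×ᵗ maybeᵗ A) i (γ , just x))
  P≤S : P ≤ S
  P≤S = s≤s (+-monoʳ-≤ (size (enc Γ i γ)) (m≤n+m _ 2))

unitᵗ : Γ ⟶ unit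
unitᵗ = constant leaf (λ _ → tt) (λ _ → refl)

justᵗ : Γ ⟶ A → Γ ⟶ maybeᵗ A
justᵗ f = ⟨ unitᵗ , f ⟩
        ⨟ retype (λ _ (_ , x) → just x) (λ _ _ → refl)

nothingᵗ : Γ ⟶ maybeᵗ A
nothingᵗ = constant leaf (λ _ → nothing) (λ _ → refl)

falseᵗ trueᵗ : Γ ⟶ bool
falseᵗ = constant leaf (λ _ → false) (λ _ → refl)
trueᵗ  = constant (node leaf leaf) (λ _ → true) (λ _ → refl)

notᵗ : Γ ⟶ bool → Γ ⟶ bool
notᵗ b = extensional (ifᵗ b falseᵗ trueᵗ) (λ i x → not (fun b i x)) λ i x → lemma (fun b i x)
  where
  lemma : ∀ b → (if b then false else true) ≡ not b
  lemma true  = refl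
  lemma false = refl

infixr 6 _∧ᵗ_
infixr 5 _∨ᵗ_

_∧ᵗ_ _∨ᵗ_ : Γ ⟶ bool → Γ ⟶ bool → Γ ⟶ bool
a ∧ᵗ b = extensional (ifᵗ a b falseᵗ) (λ i x → fun a i x ∧ fun b i x) λ i x → lemma (fun a i x)
  where
  lemma : ∀ a {b} → (if a then b else false) ≡ a ∧ b
  lemma true  = refl
  lemma false = refl
a ∨ᵗ b = extensional (ifᵗ a trueᵗ b) (λ i x → fun a i x ∨ fun b i x) λ i x → lemma (fun a i x)
  where
  lemma : ∀ a {b} → (if a then true else b) ≡ a ∨ b
  lemma true  = refl
  lemma false = refl

[]ᵗ : Γ ⟶ list A
[]ᵗ = constant leaf (λ _ → []) (λ _ → refl)

infixr 5 _∷ᵗ_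

_∷ᵗ_ : Γ ⟶ A → Γ ⟶ list A → Γ ⟶ list A
f ∷ᵗ g = ⟨ f , g ⟩ ⨟ retype (λ _ (x , xs) → x ∷ xs) (λ _ _ → refl)

tailᵗ : list A ⟶ list A
tailᵗ .fun i = drop 1
tailᵗ .prog  = tl
tailᵗ .cost  = const 1
tailᵗ .runs i []       = 1 , tl-leaf , ≤-refl
tailᵗ .runs i (x ∷ xs) = 1 , tl-node , ≤-refl

nonEmptyᵗ : list A ⟶ bool
nonEmptyᵗ .fun i = not ∘ null
nonEmptyᵗ .prog  = ifte skip (pair nil nil) nil
nonEmptyᵗ .cost  = const 7
nonEmptyᵗ .runs i []       = _ , if-leaf skip⇓ nil⇓ , s≤s (s≤s (s≤s z≤n))
nonEmptyᵗ .runs i (x ∷ xs) = _ , if-node skip⇓ (pair⇓ nil⇓ nil⇓) , ≤-refl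

module _ {X Y : Set} (f : Y → X → List X → Y) where

  -- The step is also given the entries still to come: `suffixesᵗ` collects them, as positions in a
  -- list will be represented by suffixes.
  foldSuffixes : Y → List X → Y
  foldSuffixes y []       = y
  foldSuffixes y (x ∷ xs) = foldSuffixes (f y x xs) xs

length≤size : ∀ (A : Ty I) i xs → length xs ≤ size (enc (list A) i xs)
length≤size A i []       = z≤n
length≤size A i (x ∷ xs) = s≤s (≤-trans (length≤size A i xs) (m≤n+m _ _))

-- A loop over a list runs in polynomial time provided that each iteration
-- enlarges the accumulator by an amount that does not depend on the
-- accumulator itself.
module Fold {I : Set} {Γ A B : Ty I}
  (step : (Γ ×ᵗ B) ×ᵗ (A ×ᵗ list A) ⟶ B) (increment : Poly)
  (bounded : ∀ i γ b x xs →
    size (enc B i (fun step i ((γ , b) , (x , xs))))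
      ≤ size (enc B i b) + ⟦ increment ⟧ (size (enc Γ i γ) + size (enc (list A) i (x ∷ xs))))
  where

  body loop : Prog
  body = pair (pair (hd ⨾ hd) (prog step)) (tl ⨾ tl)
  loop = while tl body

  next : ∀ i → Carrier Γ i → Carrier B i → Carrier A i → List (Carrier A i) → Carrier B i
  next i γ b x xs = fun step i ((γ , b) , (x , xs))

  module _ (i : I) (γ : Carrier Γ i) (S M : ℕ) where

    private
      -- `S` is to bound environment and remaining list, `M` the accumulator throughout the loop;
      -- `W` then bounds the whole store, and `K` one round: the step on a store of size `W`, two
      -- pairings, and 6 for tests and projections.
      W = 2 + M + S
      K = 6 + ⟦ cost step ⟧ W + (W + W)

      sγ = size (enc Γ i γ)

      sizeᴮ : Carrier B i → ℕ
      sizeᴮ b = size (enc B i b)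

      sizeᴬ : List (Carrier A i) → ℕ
      sizeᴬ xs = size (enc (list A) i xs)

      state≤W : ∀ b xs → sizeᴮ b ≤ M → sγ + sizeᴬ xs ≤ S →
                size (enc ((Γ ×ᵗ B) ×ᵗ list A) i ((γ , b) , xs)) ≤ W
      state≤W b xs b≤ xs≤ = begin
        2 + (sγ + sizeᴮ b + sizeᴬ xs)   ≡⟨ cong (2 +_) (rearrange sγ (sizeᴮ b) (sizeᴬ xs)) ⟩
        2 + (sizeᴮ b + (sγ + sizeᴬ xs)) ≤⟨ +-monoʳ-≤ 2 (+-mono-≤ b≤ xs≤) ⟩
        2 + M + S                      ∎
        where
        open ℕ.≤-Reasoning
        rearrange : ∀ a b c → a + b + c ≡ b + (a + c)
        rearrange a b c = trans (cong (_+ c) (+-comm a b)) (+-assoc b a c)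

    -- The premise on `M` is the loop invariant: there is room for the accumulator and for all that
    -- the remaining rounds may add. Each round uses up one summand.
    loop-runs : ∀ b xs → sγ + sizeᴬ xs ≤ S → sizeᴮ b + length xs * ⟦ increment ⟧ S ≤ M →
      Within loop (enc ((Γ ×ᵗ B) ×ᵗ list A) i ((γ , b) , xs))
        (enc ((Γ ×ᵗ B) ×ᵗ list A) i ((γ , foldSuffixes (next i γ) b xs) , []))
        (2 + length xs * K)
    loop-runs b [] xs≤ b≤ = 2 , while-leaf tl-node , ≤-refl
    loop-runs b (x ∷ xs) xs≤ b≤ =
      let d , t , d≤ = runs step i ((γ , b) , (x , xs))
          e , u , e≤ = loop-runs b′ xs rest≤ b′+≤M
      in _ , while-node tl-node
               (pair⇓ (pair⇓ (seq⇓ hd-node hd-node) t) (seq⇓ tl-node tl-node)) u ,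
         (begin
           2 + (2 + d + s₁ + 2 + s₂) + e
             ≡⟨ rearrange d s₁ s₂ e ⟩
           (6 + d + (s₁ + s₂)) + e
             ≤⟨ +-mono-≤ (+-mono-≤ (+-monoʳ-≤ 6 (≤-trans d≤ (⟦⟧-mono (cost step)
                  (state≤W b (x ∷ xs) (≤-trans (m≤m+n _ _) b≤) xs≤))))
                  (+-mono-≤ (≤-trans s₁≤s₂ s₂≤W) s₂≤W)) e≤ ⟩
           K + (2 + length xs * K)
             ≡⟨ +-assoc K 2 _ ⟨
           (K + 2) + length xs * K
             ≡⟨ cong (_+ length xs * K) (+-comm K 2) ⟩
           2 + (K + length xs * K) ∎)
      where
      open ℕ.≤-Reasoning
      b′ = next i γ b x xs
      s₁ = size (node (enc Γ i γ) (enc B i b′))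
      s₂ = size (enc ((Γ ×ᵗ B) ×ᵗ list A) i ((γ , b′) , xs))
      rest≤ : sγ + sizeᴬ xs ≤ S
      rest≤ = ≤-trans (+-monoʳ-≤ sγ (≤-trans (m≤n+m _ (size (enc A i x))) (n≤1+n _))) xs≤
      b′+≤M : sizeᴮ b′ + length xs * ⟦ increment ⟧ S ≤ M
      b′+≤M = begin
        sizeᴮ b′ + length xs * ⟦ increment ⟧ S
          ≤⟨ +-monoˡ-≤ _ (≤-trans (bounded i γ b x xs) (+-monoʳ-≤ (sizeᴮ b) (⟦⟧-mono increment xs≤))) ⟩
        sizeᴮ b + ⟦ increment ⟧ S + length xs * ⟦ increment ⟧ S
          ≡⟨ +-assoc (sizeᴮ b) _ _ ⟩
        sizeᴮ b + length (x ∷ xs) * ⟦ increment ⟧ S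
          ≤⟨ b≤ ⟩
        M ∎
      s₁≤s₂ : s₁ ≤ s₂
      s₁≤s₂ = ≤-trans (m≤m+n s₁ (sizeᴬ xs)) (n≤1+n _)
      s₂≤W : s₂ ≤ W
      s₂≤W = state≤W b′ xs (≤-trans (m≤m+n _ _) b′+≤M) rest≤
      rearrange : ∀ d s₁ s₂ e → 2 + (2 + d + s₁ + 2 + s₂) + e ≡ (6 + d + (s₁ + s₂)) + e
      rearrange = solve 4 (λ d s₁ s₂ e →
        con 2 :+ (con 2 :+ d :+ s₁ :+ con 2 :+ s₂) :+ e := (con 6 :+ d :+ (s₁ :+ s₂)) :+ e) refl
        where open +-*-Solver

  private
    -- This is `W` with the input size for `S` and, for `M`, the input size plus one increment per
    -- entry.
    w = const 2 ⊕ (var ⊕ var ⊗ increment) ⊕ var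

  fold : (Γ ×ᵗ B) ×ᵗ list A ⟶ B
  fold .fun i ((γ , b) , xs) = foldSuffixes (next i γ) b xs
  fold .prog = loop ⨾ (hd ⨾ tl)
  fold .cost = const 2 ⊕ var ⊗ (const 6 ⊕ cost step after w ⊕ (w ⊕ w)) ⊕ const 2
  fold .runs i ((γ , b) , xs) =
    let c , r , c≤ = loop-runs i γ s (s + s * ⟦ increment ⟧ s) b xs xs≤s
                       (+-mono-≤ b≤s (*-monoˡ-≤ _ len≤s))
    in _ , seq⇓ r (seq⇓ hd-node tl-node) ,
       +-monoˡ-≤ 2 (≤-trans c≤ (+-monoʳ-≤ 2 (*-mono-≤ len≤s
         (≤-reflexive (cong (λ z → 6 + z + (⟦ w ⟧ s + ⟦ w ⟧ s)) (sym (⟦after⟧ (cost step) _ s)))))))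
    where
    s = size (enc ((Γ ×ᵗ B) ×ᵗ list A) i ((γ , b) , xs))
    g = size (enc Γ i γ)
    sb = size (enc B i b)
    sxs = size (enc (list A) i xs)
    b≤s : sb ≤ s
    b≤s = ≤-trans (m≤n+m sb g) (≤-trans (m≤m+n (g + sb) sxs) (m≤n+m _ 2))
    len≤s : length xs ≤ s
    len≤s = ≤-trans (length≤size A i xs) (m≤n+m sxs (2 + (g + sb)))
    xs≤s : g + sxs ≤ s
    xs≤s = ≤-trans (+-monoˡ-≤ sxs (m≤m+n g sb)) (m≤n+m _ 2)

open Fold public using (fold)

-- Programs on lists and numbers

envᵗ : (Γ ×ᵗ B) ×ᵗ A ⟶ Γ
envᵗ = fst ⨟ fst

accᵗ : (Γ ×ᵗ B) ×ᵗ A ⟶ B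
accᵗ = fst ⨟ snd

itemᵗ : (Γ ×ᵗ B) ×ᵗ (A ×ᵗ C) ⟶ A
itemᵗ = snd ⨟ fst

foldSuffixes-∷ : {X : Set} (xs ys : List X) →
  foldSuffixes (λ acc x _ → x ∷ acc) ys xs ≡ xs ʳ++ ys
foldSuffixes-∷ []       ys = refl
foldSuffixes-∷ (x ∷ xs) ys = foldSuffixes-∷ xs (x ∷ ys)

revAppend : list A ×ᵗ list A ⟶ list A
revAppend {A = A} = extensional
  (⟨ ⟨ unitᵗ , snd ⟩ , fst ⟩ ⨟ fold {Γ = unit} (itemᵗ ∷ᵗ accᵗ) (const 1 ⊕ var) bounded)
  (λ _ (xs , ys) → xs ʳ++ ys) (λ _ (xs , ys) → foldSuffixes-∷ xs ys)
  where
  bounded = λ i γ acc x xs → begin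
    1 + size (enc A i x) + size (enc (list A) i acc)
      ≡⟨ +-comm (1 + size (enc A i x)) _ ⟩
    size (enc (list A) i acc) + (1 + size (enc A i x))
      ≤⟨ +-monoʳ-≤ (size (enc (list A) i acc))
           (s≤s (≤-trans (m≤m+n _ _) (≤-trans (n≤1+n _) (n≤1+n _)))) ⟩
    size (enc (list A) i acc) + (1 + (1 + (1 + size (enc A i x) + size (enc (list A) i xs)))) ∎
    where open ℕ.≤-Reasoning

foldSuffixes-ʳ++ : {X Y : Set} (f : X → List Y) (xs : List X) (ys : List Y) →
  foldSuffixes (λ acc x _ → f x ʳ++ acc) ys xs ≡ concatMap f xs ʳ++ ys
foldSuffixes-ʳ++ f []       ys = refl
foldSuffixes-ʳ++ f (x ∷ xs) ys = trans (foldSuffixes-ʳ++ f xs (f x ʳ++ ys)) (sym (++-ʳ++ (f x)))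

size-ʳ++ : ∀ (A : Ty I) i xs ys →
  size (enc (list A) i (xs ʳ++ ys)) ≤ size (enc (list A) i ys) + size (enc (list A) i xs)
size-ʳ++ A i []       ys = m≤m+n _ 1
size-ʳ++ A i (x ∷ xs) ys = ≤-trans (size-ʳ++ A i xs (x ∷ ys)) (≤-reflexive (begin
  1 + size (enc A i x) + sy + sx     ≡⟨ cong (_+ sx) (+-comm (1 + size (enc A i x)) sy) ⟩
  sy + (1 + size (enc A i x)) + sx   ≡⟨ +-assoc sy _ sx ⟩
  sy + (1 + size (enc A i x) + sx)   ∎))
  where
  open ≡-Reasoning
  sx = size (enc (list A) i xs)
  sy = size (enc (list A) i ys)

-- The loop collects the results in reverse order, which a last `revAppend` undoes. Prepending each
-- piece keeps the growth per round independent of the accumulator, as `fold` requires.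
concatMapᵗ : Γ ⟶ list A → Γ ×ᵗ A ⟶ list B → Γ ⟶ list B
concatMapᵗ {Γ = Γ} {A = A} {B = B} as f = extensional
  (⟨ ⟨ ⟨ idᵗ , []ᵗ ⟩ , as ⟩
     ⨟ fold (⟨ ⟨ envᵗ , itemᵗ ⟩ ⨟ f , accᵗ ⟩ ⨟ revAppend) (growth f) bounded
   , []ᵗ ⟩ ⨟ revAppend)
  (λ i γ → concatMap (λ x → fun f i (γ , x)) (fun as i γ))
  (λ i γ → trans (cong (_ʳ++ []) (foldSuffixes-ʳ++ (λ x → fun f i (γ , x)) (fun as i γ) []))
                 (reverse-involutive _))
  where
  bounded = λ i γ acc x xs →
    ≤-trans (size-ʳ++ B i (fun f i (γ , x)) acc)
      (+-monoʳ-≤ (size (enc (list B) i acc)) (≤-trans (size-fun f i (γ , x))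
        (⟦⟧-mono (growth f) (≤-trans (≤-reflexive (sym (+-suc (size (enc Γ i γ)) _)))
          (+-monoʳ-≤ (size (enc Γ i γ)) (m≤m+n (suc (size (enc A i x))) _))))))

concatMap-[-] : {X Y : Set} (f : X → Y) (xs : List X) →
  concatMap (λ x → [ f x ]) xs ≡ List.map f xs
concatMap-[-] f []       = refl
concatMap-[-] f (x ∷ xs) = cong (f x ∷_) (concatMap-[-] f xs)

mapᵗ : Γ ⟶ list A → Γ ×ᵗ A ⟶ B → Γ ⟶ list B
mapᵗ as f = extensional (concatMapᵗ as (f ∷ᵗ []ᵗ))
  (λ i γ → List.map (λ x → fun f i (γ , x)) (fun as i γ))
  (λ i γ → concatMap-[-] _ (fun as i γ))

concatMap-filter : {X : Set} (p : X → Bool) (xs : List X) →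
  concatMap (λ x → if p x then [ x ] else []) xs ≡ filterᵇ p xs
concatMap-filter p []       = refl
concatMap-filter p (x ∷ xs) with p x
... | true  = cong (x ∷_) (concatMap-filter p xs)
... | false = concatMap-filter p xs

filterᵗ : Γ ⟶ list A → Γ ×ᵗ A ⟶ bool → Γ ⟶ list A
filterᵗ as p = extensional (concatMapᵗ as (ifᵗ p (snd ∷ᵗ []ᵗ) []ᵗ))
  (λ i γ → filterᵇ (λ x → fun p i (γ , x)) (fun as i γ))
  (λ i γ → concatMap-filter _ (fun as i γ))

foldSuffixes-∧ : {X : Set} (p : X → Bool) (b : Bool) (xs : List X) →
  foldSuffixes (λ acc x _ → acc ∧ p x) b xs ≡ b ∧ all p xs
foldSuffixes-∧ p true  []       = refl
foldSuffixes-∧ p false []       = refl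
foldSuffixes-∧ p b     (x ∷ xs) =
  trans (foldSuffixes-∧ p (b ∧ p x) xs) (∧-assoc b (p x) (all p xs))

size-encBool : ∀ b → size (encBool b) ≤ 3
size-encBool true  = ≤-refl
size-encBool false = s≤s z≤n

allᵗ : Γ ⟶ list A → Γ ×ᵗ A ⟶ bool → Γ ⟶ bool
allᵗ as p = extensional
  (⟨ ⟨ idᵗ , trueᵗ ⟩ , as ⟩ ⨟ fold (accᵗ ∧ᵗ (⟨ envᵗ , itemᵗ ⟩ ⨟ p)) (const 3)
    λ i γ b x xs → ≤-trans (size-encBool (b ∧ fun p i (γ , x))) (m≤n+m 3 (size (encBool b))))
  (λ i γ → all (λ x → fun p i (γ , x)) (fun as i γ))
  (λ i γ → foldSuffixes-∧ _ true (fun as i γ))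

suffixes : {X : Set} → List X → List (List X)
suffixes []       = []
suffixes (x ∷ xs) = (x ∷ xs) ∷ suffixes xs

foldSuffixes-suffixes : {X : Set} (xs : List X) (yss : List (List X)) →
  foldSuffixes (λ acc x xs → (x ∷ xs) ∷ acc) yss xs ≡ suffixes xs ʳ++ yss
foldSuffixes-suffixes []       yss = refl
foldSuffixes-suffixes (x ∷ xs) yss = foldSuffixes-suffixes xs ((x ∷ xs) ∷ yss)

suffixesᵗ : list A ⟶ list (list A)
suffixesᵗ {A = A} = extensional
  (⟨ ⟨ ⟨ unitᵗ , []ᵗ ⟩ , idᵗ ⟩ ⨟ fold {Γ = unit}
       ((snd ⨟ retype (λ _ (x , xs) → x ∷ xs) (λ _ _ → refl)) ∷ᵗ accᵗ) (const 1 ⊕ var) bounded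
   , []ᵗ ⟩ ⨟ revAppend)
  (λ _ → suffixes)
  (λ _ xs → trans (cong (_ʳ++ []) (foldSuffixes-suffixes xs [])) (reverse-involutive _))
  where
  bounded = λ i γ acc x xs → begin
    1 + size (enc (list A) i (x ∷ xs)) + size (enc (list (list A)) i acc)
      ≡⟨ +-comm (1 + size (enc (list A) i (x ∷ xs))) _ ⟩
    size (enc (list (list A)) i acc) + (1 + size (enc (list A) i (x ∷ xs)))
      ≤⟨ +-monoʳ-≤ (size (enc (list (list A)) i acc)) (n≤1+n _) ⟩
    size (enc (list (list A)) i acc) + (1 + (1 + size (enc (list A) i (x ∷ xs)))) ∎
    where open ℕ.≤-Reasoning

-- Lengths are compared without counting: each entry of one list removes one from the other, and
-- what matters is whether anything is left.
foldSuffixes-drop : {X Y : Set} (xs : List X) (ys : List Y) →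
  not (null (foldSuffixes (λ acc _ _ → drop 1 acc) ys xs)) ≡ (length xs <ᵇ length ys)
foldSuffixes-drop []       []       = refl
foldSuffixes-drop []       (y ∷ ys) = refl
foldSuffixes-drop (x ∷ xs) []       = foldSuffixes-drop xs []
foldSuffixes-drop (x ∷ xs) (y ∷ ys) = foldSuffixes-drop xs ys

shorter : list A ×ᵗ list B ⟶ bool
shorter {B = B} = extensional
  (⟨ ⟨ unitᵗ , snd ⟩ , fst ⟩ ⨟ fold {Γ = unit} (accᵗ ⨟ tailᵗ) (const 0)
     (λ i γ ys x xs → ≤-trans (size-drop i ys) (m≤m+n _ 0)) ⨟ nonEmptyᵗ)
  (λ _ (xs , ys) → length xs <ᵇ length ys) (λ _ (xs , ys) → foldSuffixes-drop xs ys)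
  where
  size-drop : ∀ i ys → size (enc (list B) i (drop 1 ys)) ≤ size (enc (list B) i ys)
  size-drop i []       = ≤-refl
  size-drop i (y ∷ ys) = m≤n+m _ (1 + size (enc B i y))

enc-replicate : ∀ (i : I) n → enc (list unit) i (replicate n tt) ≡ encParam n
enc-replicate i zero    = refl
enc-replicate i (suc n) = cong (node leaf) (enc-replicate i n)

enc-length : ∀ (i : I) xs → encParam (length xs) ≡ enc (list unit) i xs
enc-length i []       = refl
enc-length i (_ ∷ xs) = cong (node leaf) (enc-length i xs)

fromNat : nat {I} ⟶ list unit
fromNat = retype (λ _ n → replicate n tt) enc-replicate

toNat : list unit ⟶ nat {I}
toNat = retype (λ _ → length) enc-length

plus times : nat {I} ×ᵗ nat ⟶ nat
plus = extensional (⟨ fst ⨟ fromNat , snd ⨟ fromNat ⟩ ⨟ revAppend ⨟ toNat)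
  (λ _ (m , n) → m + n)
  (λ _ (m , n) → trans (length-ʳ++ (replicate m tt))
                       (cong₂ _+_ (length-replicate m) (length-replicate n)))
times = extensional (concatMapᵗ (fst ⨟ fromNat) (fst ⨟ snd ⨟ fromNat) ⨟ toNat)
  (λ _ (m , n) → m * n) (λ _ (m , n) → lemma m n)
  where
  lemma : ∀ m n → length (concatMap (λ _ → replicate n tt) (replicate m tt)) ≡ m * n
  lemma zero    n = refl
  lemma (suc m) n = trans (length-++ (replicate n tt))
                          (cong₂ _+_ (length-replicate n) (lemma m n))

-- Serves both for the parameter that the reduction outputs and for the computability of the bounds
-- `g` and `h`.
polynomial : Poly → nat {I} ⟶ nat
polynomial {I = I} p = extensional (compute p) (λ _ → ⟦ p ⟧) (compute-⟦⟧ p)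
  where
  compute : Poly → nat {I} ⟶ nat
  compute (const c) = constant (encParam c) (λ _ → c) (λ _ → refl)
  compute var       = idᵗ
  compute (p ⊕ q)   = ⟨ compute p , compute q ⟩ ⨟ plus
  compute (p ⊗ q)   = ⟨ compute p , compute q ⟩ ⨟ times
  compute-⟦⟧ : ∀ p (i : I) n → fun (compute p) i n ≡ ⟦ p ⟧ n
  compute-⟦⟧ (const c) i n = refl
  compute-⟦⟧ var       i n = refl
  compute-⟦⟧ (p ⊕ q)   i n = cong₂ _+_ (compute-⟦⟧ p i n) (compute-⟦⟧ q i n)
  compute-⟦⟧ (p ⊗ q)   i n = cong₂ _*_ (compute-⟦⟧ p i n) (compute-⟦⟧ q i n)

computable : ∀ p → Computable ⟦ p ⟧
computable p = prog f , λ k → proj₁ (runs f tt k) , proj₁ (proj₂ (runs f tt k))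
  where
  f : nat {⊤} ⟶ nat
  f = polynomial p

-- Comparison of binary integers

binary integer : Ty I
binary .Carrier _  = ℕᵇ
binary .enc _      = encℕᵇ
integer .Carrier _ = ℤ
integer .enc _     = encℤ

-- The digits 1 and 2 are read as `true` and `false`.
digits : ℕᵇ → List Bool
digits zero     = []
digits 2[1+ x ] = false ∷ digits x
digits 1+[2 x ] = true ∷ digits x

enc-digits : ∀ x → encList encBool (digits x) ≡ encℕᵇ x
enc-digits zero     = refl
enc-digits 2[1+ x ] = cong (node leaf) (enc-digits x)
enc-digits 1+[2 x ] = cong (node (node leaf leaf)) (enc-digits x)

-- The Boolean is the verdict in case of a tie. Digits come least significant first, so a difference
-- between the current digits decides only if all later digits tie, and is passed on as their
-- verdict.
lessOr : Bool → ℕᵇ → ℕᵇ → Bool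
lessOr v zero     zero     = v
lessOr v zero     2[1+ y ] = true
lessOr v zero     1+[2 y ] = true
lessOr v 2[1+ x ] zero     = false
lessOr v 1+[2 x ] zero     = false
lessOr v 2[1+ x ] 2[1+ y ] = lessOr v x y
lessOr v 2[1+ x ] 1+[2 y ] = lessOr false x y
lessOr v 1+[2 x ] 2[1+ y ] = lessOr true x y
lessOr v 1+[2 x ] 1+[2 y ] = lessOr v x y

lessOr-sound : ∀ v x y → T (lessOr v x y) → x ℕᵇ.< y ⊎ (x ≡ y × T v)
lessOr-sound v zero     zero     p = inj₂ (refl , p)
lessOr-sound v zero     2[1+ y ] p = inj₁ ℕᵇ.0<even
lessOr-sound v zero     1+[2 y ] p = inj₁ ℕᵇ.0<odd
lessOr-sound v 2[1+ x ] 2[1+ y ] p with lessOr-sound v x y p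
... | inj₁ x<y        = inj₁ (ℕᵇ.even<even x<y)
... | inj₂ (refl , q) = inj₂ (refl , q)
lessOr-sound v 2[1+ x ] 1+[2 y ] p with lessOr-sound false x y p
... | inj₁ x<y        = inj₁ (ℕᵇ.even<odd x<y)
lessOr-sound v 1+[2 x ] 2[1+ y ] p with lessOr-sound true x y p
... | inj₁ x<y        = inj₁ (ℕᵇ.odd<even (inj₁ x<y))
... | inj₂ (refl , q) = inj₁ (ℕᵇ.odd<even (inj₂ refl))
lessOr-sound v 1+[2 x ] 1+[2 y ] p with lessOr-sound v x y p
... | inj₁ x<y        = inj₁ (ℕᵇ.odd<odd x<y)
... | inj₂ (refl , q) = inj₂ (refl , q)

lessOr-refl : ∀ x → T (lessOr true x x)
lessOr-refl zero     = _
lessOr-refl 2[1+ x ] = lessOr-refl x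
lessOr-refl 1+[2 x ] = lessOr-refl x

lessOr-< : ∀ v {x y} → x ℕᵇ.< y → T (lessOr v x y)
lessOr-< v ℕᵇ.0<even                 = _
lessOr-< v ℕᵇ.0<odd                  = _
lessOr-< v (ℕᵇ.even<even x<y)        = lessOr-< v x<y
lessOr-< v (ℕᵇ.even<odd x<y)         = lessOr-< false x<y
lessOr-< v (ℕᵇ.odd<even (inj₁ x<y))  = lessOr-< true x<y
lessOr-< v {1+[2 x ]} (ℕᵇ.odd<even (inj₂ refl)) = lessOr-refl x
lessOr-< v (ℕᵇ.odd<odd x<y)          = lessOr-< v x<y

-- The default is dictated by `hd`, which turns the empty list `leaf` into `leaf`, the encoding of
-- `false`.
headOrFalse : List Bool → Bool
headOrFalse []      = false
headOrFalse (b ∷ _) = b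

headOrFalseᵗ : list bool ⟶ bool {I}
headOrFalseᵗ .fun i = headOrFalse
headOrFalseᵗ .prog = hd
headOrFalseᵗ .cost = const 1
headOrFalseᵗ .runs i []      = 1 , hd-leaf , ≤-refl
headOrFalseᵗ .runs i (b ∷ _) = 1 , hd-node , ≤-refl

-- Both numerals are read from the least significant digit on. The accumulator
-- holds the rest of the second one and whether the part of the first one read
-- so far is at most the corresponding part of the second one. As the
-- numeration is bijective, a number with more digits is larger.
lessOrᵗ : bool {I} ×ᵗ binary ×ᵗ binary ⟶ bool
lessOrᵗ {I = I} = extensional
  (⟨ ⟨ unitᵗ , ⟨ snd ⨟ snd ⨟ toDigits , fst ⟩ ⟩ , snd ⨟ fst ⨟ toDigits ⟩
   ⨟ fold {Γ = unit} compareDigit (const 3) bounded ⨟ ((fst ⨟ nonEmptyᵗ) ∨ᵗ snd))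
  (λ _ (v , x , y) → lessOr v x y) (λ i (v , x , y) → correct i v x y)
  where
  toDigits : binary ⟶ list (bool {I})
  toDigits = retype (λ _ → digits) (λ _ → enc-digits)

  rest : (unit ×ᵗ (list bool ×ᵗ bool)) ×ᵗ (bool ×ᵗ list bool) ⟶ list (bool {I})
  rest = accᵗ ⨟ fst

  compareDigit : (unit ×ᵗ (list bool ×ᵗ bool)) ×ᵗ (bool ×ᵗ list bool) ⟶ list bool ×ᵗ bool {I}
  compareDigit = ifᵗ (rest ⨟ nonEmptyᵗ)
    ⟨ rest ⨟ tailᵗ
    , ifᵗ itemᵗ (ifᵗ (rest ⨟ headOrFalseᵗ) (accᵗ ⨟ snd) trueᵗ)
                (ifᵗ (rest ⨟ headOrFalseᵗ) falseᵗ (accᵗ ⨟ snd)) ⟩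
    -- The second numeral has run out of digits before the first: the first number is larger,
    -- whatever follows.
    ⟨ []ᵗ , falseᵗ ⟩

  bounded : ∀ (i : I) γ b x xs →
    size (enc (list bool ×ᵗ bool) i (fun compareDigit i ((γ , b) , (x , xs))))
      ≤ size (enc (list bool ×ᵗ bool) i b) + 3
  bounded i γ ([] , v) x xs = m≤n+m 3 (2 + size (encBool v))
  bounded i γ (y ∷ ys , v) x xs = s≤s (+-mono-≤
    (≤-trans (m≤n+m (size (encList encBool ys)) (1 + size (encBool y)))
             (m≤m+n _ (size (encBool v))))
    (size-encBool (proj₂ (fun compareDigit i ((γ , (y ∷ ys , v)) , (x , xs))))))

  result : I → Bool → List Bool → List Bool → Bool
  result i v xs ys =
    let zs , w = foldSuffixes (λ acc x xs → fun compareDigit i ((tt , acc) , (x , xs))) (ys , v) xs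
    in not (null zs) ∨ w

  exhausted : ∀ i xs → result i false xs [] ≡ false
  exhausted i []       = refl
  exhausted i (x ∷ xs) = exhausted i xs

  correct : ∀ i v x y → result i v (digits x) (digits y) ≡ lessOr v x y
  correct i v zero     zero     = refl
  correct i v zero     2[1+ y ] = refl
  correct i v zero     1+[2 y ] = refl
  correct i v 2[1+ x ] zero     = exhausted i (digits x)
  correct i v 1+[2 x ] zero     = exhausted i (digits x)
  correct i v 2[1+ x ] 2[1+ y ] = correct i v x y
  correct i v 2[1+ x ] 1+[2 y ] = correct i false x y
  correct i v 1+[2 x ] 2[1+ y ] = correct i true x y
  correct i v 1+[2 x ] 1+[2 y ] = correct i v x y

signed : ℤ → Bool × ℕᵇ
signed (ℤ.+ n)    = false , fromℕ n
signed -[1+ n ] = true , fromℕ n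

_≤ℤᵇ_ : ℤ → ℤ → Bool
(ℤ.+ m)    ≤ℤᵇ (ℤ.+ n)    = lessOr true (fromℕ m) (fromℕ n)
(ℤ.+ m)    ≤ℤᵇ -[1+ n ] = false
-[1+ m ] ≤ℤᵇ (ℤ.+ n)    = true
-[1+ m ] ≤ℤᵇ -[1+ n ] = lessOr true (fromℕ n) (fromℕ m)

atMostᵗ : integer {I} ×ᵗ integer ⟶ bool
atMostᵗ {I = I} = extensional
  (⟨ fst ⨟ toSigned , snd ⨟ toSigned ⟩
   ⨟ ifᵗ (fst ⨟ fst)
      (ifᵗ (snd ⨟ fst) (⟨ trueᵗ , ⟨ snd ⨟ snd , fst ⨟ snd ⟩ ⟩ ⨟ lessOrᵗ) trueᵗ)
      (ifᵗ (snd ⨟ fst) falseᵗ (⟨ trueᵗ , ⟨ fst ⨟ snd , snd ⨟ snd ⟩ ⟩ ⨟ lessOrᵗ)))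
  (λ _ (x , y) → x ≤ℤᵇ y) correct
  where
  toSigned : integer {I} ⟶ bool ×ᵗ binary
  toSigned = retype (λ _ → signed) λ { _ (ℤ.+ n) → refl ; _ -[1+ n ] → refl }
  correct : ∀ _ xy → _ ≡ proj₁ xy ≤ℤᵇ proj₂ xy
  correct i (ℤ.+ m    , ℤ.+ n)      = refl
  correct i (ℤ.+ m    , -[1+ n ]) = refl
  correct i (-[1+ m ] , ℤ.+ n)    = refl
  correct i (-[1+ m ] , -[1+ n ]) = refl

lessOr-fromℕ-sound : ∀ m n → T (lessOr true (fromℕ m) (fromℕ n)) → m ≤ n
lessOr-fromℕ-sound m n p with lessOr-sound true (fromℕ m) (fromℕ n) p
... | inj₁ m<n        = <⇒≤ (subst₂ _<_ (ℕᵇ.toℕ-fromℕ m) (ℕᵇ.toℕ-fromℕ n) (ℕᵇ.toℕ-mono-< m<n))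
... | inj₂ (m≡n , _)  = ≤-reflexive (ℕᵇ.fromℕ-injective m≡n)

lessOr-fromℕ-complete : ∀ {m n} → m ≤ n → T (lessOr true (fromℕ m) (fromℕ n))
lessOr-fromℕ-complete {m} {n} m≤n with m≤n⇒m<n∨m≡n m≤n
... | inj₁ m<n  = lessOr-< true {fromℕ m} {fromℕ n} (ℕᵇ.toℕ-cancel-<
                    (subst₂ _<_ (sym (ℕᵇ.toℕ-fromℕ m)) (sym (ℕᵇ.toℕ-fromℕ n)) m<n))
... | inj₂ refl = lessOr-refl (fromℕ m)

≤ℤᵇ-sound : ∀ x y → T (x ≤ℤᵇ y) → x ℤ.≤ y
≤ℤᵇ-sound (ℤ.+ m)    (ℤ.+ n)    p = ℤ.+≤+ (lessOr-fromℕ-sound m n p)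
≤ℤᵇ-sound -[1+ m ] (ℤ.+ n)    p = ℤ.-≤+
≤ℤᵇ-sound -[1+ m ] -[1+ n ] p = ℤ.-≤- (lessOr-fromℕ-sound n m p)

≤ℤᵇ-complete : ∀ {x y} → x ℤ.≤ y → T (x ≤ℤᵇ y)
≤ℤᵇ-complete (ℤ.-≤- n≤m) = lessOr-fromℕ-complete n≤m
≤ℤᵇ-complete ℤ.-≤+       = _
≤ℤᵇ-complete (ℤ.+≤+ m≤n) = lessOr-fromℕ-complete m≤n

-- Families and vectors of fixed length

family vec : ℕ → Ty I → Ty I
family m A .Carrier i = Fin m → Carrier A i
family m A .enc i     = encFamily (enc A i)
vec m A .Carrier i    = Vec (Carrier A i) m
vec m A .enc i        = encList (enc A i) ∘ Vec.toList

component : ∀ {m} → Fin m → family m A ⟶ A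
component {A = A} {m = suc m} zero =
  retype {B = A ×ᵗ family m A} (λ _ f → f zero , f ∘ suc) (λ _ _ → refl) ⨟ fst
component {A = A} {m = suc m} (suc j) =
  retype {B = A ×ᵗ family m A} (λ _ f → f zero , f ∘ suc) (λ _ _ → refl) ⨟ snd ⨟ component j

component-lookup : ∀ {m} (j : Fin m) i (f : Carrier (family m A) i) →
  fun (component {A = A} j) i f ≡ f j
component-lookup zero    i f = refl
component-lookup {A = A} (suc j) i f = component-lookup {A = A} j i (f ∘ suc)

uncons : ∀ {m} → vec (suc m) A ⟶ A ×ᵗ vec m A
uncons = retype (λ _ xs → Vec.head xs , Vec.tail xs) (λ { _ (x ∷ xs) → refl })

headᵗ : ∀ {m} → vec (suc m) A ⟶ A
headᵗ = uncons ⨟ fst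

tailᵛ : ∀ {m} → vec (suc m) A ⟶ vec m A
tailᵛ = uncons ⨟ snd

toListᵗ : ∀ {m} → vec m A ⟶ list A
toListᵗ = retype (λ _ → Vec.toList) (λ _ _ → refl)

-- Listings of finite sets, and cliques

elements : ∀ {n} (D : Subset n) → Fin ∣ D ∣ → Fin n
elements (true ∷ D) zero    = zero
elements (true ∷ D) (suc i) = suc (elements D i)
elements (false ∷ D) i       = suc (elements D i)

elements-injective : ∀ {n} (D : Subset n) → Injective _≡_ _≡_ (elements D)
elements-injective (true ∷ D) {zero}  {zero}  _  = refl
elements-injective (true ∷ D) {suc i} {suc j} eq =
  cong suc (elements-injective D (suc-injective eq))
elements-injective (false ∷ D) eq = elements-injective D (suc-injective eq)

elements-∈ : ∀ {n} (D : Subset n) i → elements D i ∈ D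
elements-∈ (true ∷ D) zero    = here
elements-∈ (true ∷ D) (suc i) = there (elements-∈ D i)
elements-∈ (false ∷ D) i       = there (elements-∈ D i)

elements-surjective : ∀ {n} (D : Subset n) {v} → v ∈ D → ∃[ i ] elements D i ≡ v
elements-surjective (true ∷ D) here = zero , refl
elements-surjective (true ∷ D) (there v∈D) =
  let i , eq = elements-surjective D v∈D in suc i , cong suc eq
elements-surjective (false ∷ D) (there v∈D) =
  let i , eq = elements-surjective D v∈D in i , cong suc eq

record _Lists_ {k n} (d : Fin k → Fin n) (D : Subset n) : Set where
  field
    injective  : Injective _≡_ _≡_ d
    member     : ∀ i → d i ∈ D
    exhaustive : ∀ {v} → v ∈ D → ∃[ i ] d i ≡ v

open _Lists_

elements-lists : ∀ {n} (D : Subset n) → elements D Lists D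
elements-lists D = record
  { injective  = elements-injective D
  ; member     = elements-∈ D
  ; exhaustive = elements-surjective D
  }

lists-≤ : ∀ {k m n} {d : Fin k → Fin n} {e : Fin m → Fin n} →
  Injective _≡_ _≡_ d → (∀ i → ∃[ j ] e j ≡ d i) → k ≤ m
lists-≤ {e = e} d-inj covered = injective⇒≤ {f = proj₁ ∘ covered} λ {i} {j} eq →
  d-inj (trans (sym (proj₂ (covered i))) (trans (cong e eq) (proj₂ (covered j))))

fresh : ∀ {k m n} {d : Fin k → Fin n} (e : Fin m → Fin n) →
  Injective _≡_ _≡_ d → m < k → ∃[ i ] ∀ j → e j ≢ d i
fresh {d = d} e d-inj m<k with any? (λ i → all? (λ j → ¬? (e j ≟ d i)))
... | yes found = found
... | no  ¬found = contradiction (lists-≤ {e = e} d-inj covered) (ℕ.<⇒≱ m<k)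
  where
  covered : ∀ i → ∃[ j ] e j ≡ d i
  covered i with any? (λ j → e j ≟ d i)
  ... | yes found = found
  ... | no  none  = contradiction (i , λ j eq → none (j , eq)) ¬found

cons-injective : ∀ {k n} {v} {d : Fin k → Fin n} → (∀ j → d j ≢ v) → Injective _≡_ _≡_ d →
  Injective _≡_ _≡_ (v F.∷ d)
cons-injective v∉d d-inj {zero}  {zero}  _  = refl
cons-injective v∉d d-inj {zero}  {suc j} eq = contradiction (sym eq) (v∉d j)
cons-injective v∉d d-inj {suc i} {zero}  eq = contradiction eq (v∉d i)
cons-injective v∉d d-inj {suc i} {suc j} eq = cong suc (d-inj eq)

-- A missed member could be put in front of the list, giving one more different member than `D` has.
injective⇒lists : ∀ {n} {D : Subset n} {d : Fin ∣ D ∣ → Fin n} →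
  Injective _≡_ _≡_ d → (∀ i → d i ∈ D) → d Lists D
injective⇒lists {D = D} {d} d-inj d∈D = record
  { injective  = d-inj
  ; member     = d∈D
  ; exhaustive = λ {v} v∈D → decidable-stable (any? λ i → d i ≟ v) λ v∉d →
      ℕ.1+n≰n (lists-≤ {d = v F.∷ d} {e = elements D}
        (cons-injective (λ j eq → v∉d (j , eq)) d-inj)
        λ { zero → elements-surjective D v∈D ; (suc i) → elements-surjective D (d∈D i) })
  }

injective⇒surjective : ∀ {m} {f : Fin m → Fin m} → Injective _≡_ _≡_ f → ∀ y → ∃[ x ] f x ≡ y
injective⇒surjective {f = f} f-inj y = decidable-stable (any? λ x → f x ≟ y) λ y∉f →
  ℕ.1+n≰n (injective⇒≤ (cons-injective (λ j eq → y∉f (j , eq)) f-inj))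

image : ∀ {k n} → (Fin k → Fin n) → Subset n
image d = Vec.tabulate λ v → does (any? λ i → d i ≟ v)

image-∈ : ∀ {k n} (d : Fin k → Fin n) {v} → v ∈ image d ⇔ (∃[ i ] d i ≡ v)
image-∈ d {v} = mk⇔
  (λ v∈ → decidable-stable found? λ v∉d →
    contradiction (trans (sym (dec-false found? v∉d)) (trans (sym lookup≡) (Vec.[]=⇒lookup v∈))) λ ())
  (λ found → Vec.lookup⇒[]= v (image d) (trans lookup≡ (dec-true found? found)))
  where
  found?  = any? λ i → d i ≟ v
  lookup≡ = Vec.lookup∘tabulate (λ v → does (any? λ i → d i ≟ v)) v

image-lists : ∀ {k n} {d : Fin k → Fin n} → Injective _≡_ _≡_ d → d Lists image d
image-lists {d = d} d-inj = record
  { injective  = d-inj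
  ; member     = λ i → from (image-∈ d) (i , refl)
  ; exhaustive = to (image-∈ d)
  }

lists⇒∣∣ : ∀ {k n} {d : Fin k → Fin n} {D} → d Lists D → ∣ D ∣ ≡ k
lists⇒∣∣ {d = d} {D} d-lists = ℕ.≤-antisym
  (lists-≤ {e = d} (elements-injective D) λ i → exhaustive d-lists (elements-∈ D i))
  (lists-≤ {e = elements D} (injective d-lists) λ i → elements-surjective D (member d-lists i))

-- A bijection, by the next two lemmas; it lets the size demanded of the clique count the keys.
code : ∀ {K r} → Vec (Fin K) r → Fin (K ^ r)
code []       = zero
code (p ∷ ps) = combine p (code ps)

code-injective : ∀ {K r} (ps qs : Vec (Fin K) r) → code ps ≡ code qs → ps ≡ qs
code-injective []       []       eq = refl
code-injective (p ∷ ps) (q ∷ qs) eq =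
  let p≡q , eq′ = combine-injective p (code ps) q (code qs) eq
  in cong₂ _∷_ p≡q (code-injective ps qs eq′)

code-surjective : ∀ {K} r (c : Fin (K ^ r)) → ∃[ ps ] code {K} {r} ps ≡ c
code-surjective zero    zero = [] , refl
code-surjective {K} (suc r) c =
  let p , c′ , eq  = combine-surjective {m = K} c
      ps , eq′     = code-surjective r c′
  in p ∷ ps , trans (cong (combine p) eq′) eq

-- The graph on a list of labels, where labels with equal keys are never
-- joined. A clique of size M thus contains each of the M keys exactly once.
module ListGraph {X : Set} (edge : X → X → Bool) (edge-sym : ∀ x y → edge x y ≡ edge y x)
  {M : ℕ} (key : X → Fin M) (edge⇒key≢ : ∀ {x y} → T (edge x y) → key x ≢ key y) (L : List X)
  where

  graph : Graph (length L)
  graph = record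
    { adj        = λ a b → edge (lookup L a) (lookup L b)
    ; adj-sym    = λ a b → edge-sym (lookup L a) (lookup L b)
    ; adj-irrefl = λ a → ¬-not λ eq → edge⇒key≢ (from T-≡ eq) refl
    }

  record Choice : Set where
    field
      choose : Fin M → X
      listed : ∀ c → choose c ∈ˡ L
      keyed  : ∀ c → key (choose c) ≡ c
      joined : ∀ {c c′} → c ≢ c′ → T (edge (choose c) (choose c′))

  clique⇒choice : HasSetOfSize IsClique graph M → Choice
  clique⇒choice (D , refl , clique) = record
    { choose = λ c → lookup L (at c)
    ; listed = λ c → ∈-lookup (at c)
    ; keyed  = proj₂ ∘ hit
    ; joined = λ {c} {c′} c≢c′ → clique (elements-∈ D _) (elements-∈ D _) λ eq →
        c≢c′ (trans (sym (proj₂ (hit c))) (trans (cong (key ∘ lookup L) eq) (proj₂ (hit c′))))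
    }
    where
    keys : Fin ∣ D ∣ → Fin ∣ D ∣
    keys i = key (lookup L (elements D i))
    keys-injective : Injective _≡_ _≡_ keys
    keys-injective {i} {j} eq = elements-injective D (decidable-stable (_ ≟ _) λ i≢j →
      edge⇒key≢ (clique (elements-∈ D i) (elements-∈ D j) i≢j) eq)
    hit : ∀ c → ∃[ i ] keys i ≡ c
    hit = injective⇒surjective keys-injective
    at : Fin ∣ D ∣ → Fin (length L)
    at = elements D ∘ proj₁ ∘ hit

  choice⇒clique : Choice → HasSetOfSize IsClique graph M
  choice⇒clique choice = image at , lists⇒∣∣ (image-lists at-injective) , clique
    where
    open Choice choice
    at : Fin M → Fin (length L)
    at = index ∘ listed
    lookup-at : ∀ c → choose c ≡ lookup L (at c)
    lookup-at = lookup-index ∘ listed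
    at-injective : Injective _≡_ _≡_ at
    at-injective {c} {c′} eq = trans (sym (keyed c)) (trans (cong key
      (trans (lookup-at c) (trans (cong (lookup L) eq) (sym (lookup-at c′))))) (keyed c′))
    clique : IsClique graph (image at)
    clique u∈ v∈ u≢v with to (image-∈ at) u∈ | to (image-∈ at) v∈
    ... | c , refl | c′ , refl = subst T (cong₂ edge (lookup-at c) (lookup-at c′))
      (joined (u≢v ∘ cong at))

-- For preorders, since thresholds of different vertices may coincide. It yields the lower end of a
-- cell and, in the opposite order, the upper end.
maximum : ∀ {k} {P : Fin k → Set} (_⊑_ : Fin k → Fin k → Set) →
  (∀ i j → i ⊑ j ⊎ j ⊑ i) → (∀ {i j l} → i ⊑ j → j ⊑ l → i ⊑ l) → (∀ i → Dec (P i)) →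
  (∃[ m ] P m × (∀ {i} → P i → i ⊑ m)) ⊎ (∀ i → ¬ P i)
maximum {zero} _⊑_ total transitive P? = inj₂ λ ()
maximum {suc k} {P} _⊑_ total transitive P?
  with P? zero | maximum (λ i j → suc i ⊑ suc j) (λ i j → total (suc i) (suc j)) transitive (P? ∘ suc)
... | no ¬p | inj₂ none = inj₂ λ { zero → ¬p ; (suc i) → none i }
... | no ¬p | inj₁ (m , pm , max) =
  inj₁ (suc m , pm , λ { {zero} p → contradiction p ¬p ; {suc i} → max })
... | yes p | inj₂ none =
  inj₁ (zero , p , λ { {zero} _ → ⊑-refl ; {suc i} q → contradiction q (none i) })
  where
  ⊑-refl : zero ⊑ zero
  ⊑-refl = [ id , id ]′ (total zero zero)
... | yes p | inj₁ (m , pm , max) with total zero (suc m)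
...   | inj₁ 0⊑m = inj₁ (suc m , pm , λ { {zero} _ → 0⊑m ; {suc i} → max })
...   | inj₂ m⊑0 = inj₁ (zero , p , λ { {zero} _ → [ id , id ]′ (total zero zero)
                                      ; {suc i} q → transitive (max q) m⊑0 })

-- Connectedness through an ordering of the vertices

module _ {n} (G : Graph n) where
  open Graph G

  ~-sym : ∀ u v → u ~ v → v ~ u
  ~-sym u v = subst T (adj-sym u v)

  -- Apart from the last one, every listed vertex has a neighbour that is
  -- listed later; the premise j < i only says that j is not the last index.
  Grown : ∀ {k} → (Fin k → Fin n) → Set
  Grown {k} d = ∀ (i j : Fin k) → j Fin.< i → ∃[ c ] j Fin.< c × d c ~ d j

  Inside : Subset n → Fin n → Fin n → Set
  Inside D x y = x ∈ D × y ∈ D × x ~ y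

  -- The first edge of the path that leaves the list.
  crossing : ∀ {D m} (d : Fin m → Fin n) {u v} → Star (Inside D) u v →
    (∃[ j ] d j ≡ u) → (∀ j → d j ≢ v) →
    ∃[ j ] ∃[ w ] w ∈ D × (∀ i → d i ≢ w) × d j ~ w
  crossing d ε (j , dj≡u) v∉d = contradiction dj≡u (v∉d j)
  crossing d {u} (_◅_ {j = w} (_ , w∈D , u~w) path) (j , refl) v∉d with any? (λ i → d i ≟ w)
  ... | yes found  = crossing d path found v∉d
  ... | no  ¬found = j , w , w∈D , (λ i eq → ¬found (i , eq)) , u~w

  Partial : Subset n → ℕ → Set
  Partial D m = ∃[ d ] Injective _≡_ _≡_ d × (∀ (i : Fin m) → d i ∈ D) × Grown d

  -- While members are missing, connectedness supplies an edge leaving the list. The new vertex goes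
  -- to the front, so that its neighbour comes later and the last vertex, the root of the growing
  -- tree, stays last.
  extend : ∀ {D m} → InducesConnected G D → suc m < ∣ D ∣ →
    Partial D (suc m) → Partial D (suc (suc m))
  extend {D} connected m<k (d , d-inj , d∈D , grown) =
    let i , i∉d = fresh d (elements-injective D) m<k
        j , w , w∈D , w∉d , j~w =
          crossing d (connected (d∈D zero) (elements-∈ D i)) (zero , refl) i∉d
    in w F.∷ d , cons-injective w∉d d-inj , (λ { zero → w∈D ; (suc i) → d∈D i }) ,
       λ { i       zero    _         → suc j , s≤s z≤n , j~w
         ; (suc i) (suc j) (s≤s j<i) →
             let c , j<c , c~j = grown i j j<i in suc c , s≤s j<c , c~j }

  grow : ∀ {D} → InducesConnected G D → ∀ m → m ≤ ∣ D ∣ → Partial D m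
  grow connected zero _ = (λ ()) , (λ { {()} }) , (λ ()) , λ ()
  grow {D} connected (suc zero) 1≤k =
    elements D ∘ pos , (λ { {zero} {zero} _ → refl }) , elements-∈ D ∘ pos , λ { zero zero () }
    where
    pos : Fin 1 → Fin ∣ D ∣
    pos _ = Fin.fromℕ< 1≤k
  grow connected (suc (suc m)) m<k =
    extend connected m<k (grow connected (suc m) (ℕ.<⇒≤ m<k))

  connected⇒grown : ∀ {k D} → ∣ D ∣ ≡ k → InducesConnected G D →
    ∃[ d ] _Lists_ {k} d D × Grown d
  connected⇒grown {D = D} refl connected =
    let d , d-inj , d∈D , grown = grow connected ∣ D ∣ ℕ.≤-refl
    in d , injective⇒lists d-inj d∈D , grown

  -- Passing on to later neighbours leads from every listed vertex to the last one, so any two are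
  -- joined by way of it.
  grown⇒connected : ∀ {k} {d : Fin k → Fin n} {D} → d Lists D → Grown d → InducesConnected G D
  grown⇒connected {suc k} {d} {D} d-lists grown u∈D v∈D
    with exhaustive d-lists u∈D | exhaustive d-lists v∈D
  ... | i , refl | j , refl = toLast i ◅◅ Star.reverse flip (toLast j)
    where
    flip : ∀ {x y} → Inside D x y → Inside D y x
    flip {x} {y} (x∈D , y∈D , x~y) = y∈D , x∈D , ~-sym x y x~y
    toLast : ∀ i → Star (Inside D) (d i) (d (Fin.fromℕ k))
    toLast i = go i (>-wellFounded i)
      where
      go : ∀ i → Acc Fin._>_ i → Star (Inside D) (d i) (d (Fin.fromℕ k))
      go i (acc rec) with i ≟ Fin.fromℕ k
      ... | yes refl = ε
      ... | no  i≢k =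
        let c , i<c , c~i = grown (Fin.fromℕ k) i (≤∧≢⇒< (≤fromℕ i) i≢k)
        in (member d-lists i , member d-lists c , ~-sym (d c) (d i) c~i) ◅ go c (rec i<c)
  grown⇒connected {zero} d-lists grown u∈D v∈D with () ← proj₁ (exhaustive d-lists u∈D)

-- Labels and their programs

∧-elim : ∀ a {b} → T (a ∧ b) → T a × T b
∧-elim true p = _ , p

∧-intro : ∀ a {b} → T a → T b → T (a ∧ b)
∧-intro true _ q = q

∧ᵗ-spec : ∀ (f g : Γ ⟶ bool) i x → T (fun (f ∧ᵗ g) i x) ⇔ (T (fun f i x) × T (fun g i x))
∧ᵗ-spec f g i x = mk⇔ (∧-elim (fun f i x)) λ (p , q) → ∧-intro (fun f i x) p q

not-elim : ∀ a → T (not a) → ¬ T a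
not-elim false _ ()

not-intro : ∀ a → ¬ T a → T (not a)
not-intro true  ¬p = ¬p _
not-intro false _  = _

T-ext : ∀ a b → (T a → T b) → (T b → T a) → a ≡ b
T-ext true  true  _ _ = refl
T-ext true  false f _ = ⊥-elim (f _)
T-ext false true  _ g = ⊥-elim (g _)
T-ext false false _ _ = refl

does-sound : ∀ {P : Set} (p? : Dec P) → T (does p?) → P
does-sound (yes p) _ = p

does-complete : ∀ {P : Set} (p? : Dec P) → P → T (does p?)
does-complete (yes _) _ = _
does-complete (no ¬p) p = ¬p p

suffix : ∀ {X : Set} {n} → (Fin n → X) → Fin n → List X
suffix f zero    = tabulate f
suffix f (suc v) = suffix (f ∘ suc) v

suffixes-tabulate : ∀ {X : Set} {n} (f : Fin n → X) → suffixes (tabulate f) ≡ tabulate (suffix f)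
suffixes-tabulate {n = zero}  f = refl
suffixes-tabulate {n = suc n} f = cong (tabulate f ∷_) (suffixes-tabulate (f ∘ suc))

suffix-∷ : ∀ {X : Set} {n} (f : Fin n → X) v → f v ∷ drop 1 (suffix f v) ≡ suffix f v
suffix-∷ f zero    = refl
suffix-∷ f (suc v) = suffix-∷ (f ∘ suc) v

length-suffix : ∀ {X : Set} {n} (f : Fin n → X) v → length (suffix f v) ≡ n ∸ toℕ v
length-suffix {n = suc n} f zero    = length-tabulate f
length-suffix             f (suc v) = length-suffix (f ∘ suc) v

encList-map : {X Y : Set} (e : Y → Tree) (f : X → Y) (xs : List X) →
  encList e (List.map f xs) ≡ encList (e ∘ f) xs
encList-map e f []       = refl
encList-map e f (x ∷ xs) = cong (node (e (f x))) (encList-map e f xs)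

-- The positions of a list, each represented by the part of the list that
-- starts there. Comparing positions amounts to comparing lengths.
module Points {I : Set} {A : Ty I} (count : I → ℕ) (entry : ∀ i → Fin (count i) → Carrier A i) where

  point : Ty I
  point .Carrier i = Fin (count i)
  point .enc i v   = enc (list A) i (suffix (entry i) v)

  asList : point ⟶ list A
  asList = retype (λ i → suffix (entry i)) (λ _ _ → refl)

  entryᵗ : point ⟶ A
  entryᵗ = recode (retype {B = A ×ᵗ list A} (λ i v → entry i v , drop 1 (suffix (entry i) v))
    (λ i v → cong (enc (list A) i) (suffix-∷ (entry i) v)) ⨟ fst) entry (λ _ _ → refl)

  points : (f : Γ ⟶ list A) → (∀ i γ → fun f i γ ≡ tabulate (entry i)) → Γ ⟶ list point
  points f eq = recode (f ⨟ suffixesᵗ) (λ i _ → allFin (count i)) λ i γ → begin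
    encList (enc point i) (allFin (count i))
      ≡⟨ encList-map (enc (list A) i) (suffix (entry i)) (allFin (count i)) ⟨
    encList (enc (list A) i) (List.map (suffix (entry i)) (allFin (count i)))
      ≡⟨ cong (encList (enc (list A) i)) (map-tabulate id (suffix (entry i))) ⟩
    encList (enc (list A) i) (tabulate (suffix (entry i)))
      ≡⟨ cong (encList (enc (list A) i)) (suffixes-tabulate (entry i)) ⟨
    encList (enc (list A) i) (suffixes (tabulate (entry i)))
      ≡⟨ cong (encList (enc (list A) i) ∘ suffixes) (eq i γ) ⟨
    encList (enc (list A) i) (suffixes (fun f i γ)) ∎
    where open ≡-Reasoning

  laterᵗ : point ×ᵗ point ⟶ bool
  laterᵗ = extensional (⟨ fst ⨟ asList , snd ⨟ asList ⟩ ⨟ shorter) (λ _ (u , v) → toℕ v <ᵇ toℕ u)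
    λ i (u , v) → T-ext _ _
      (λ p → ℕ.<⇒<ᵇ (ℕ.∸-cancelʳ-< {toℕ u} {toℕ v} {count i} (lengths i u v
        (ℕ.<ᵇ⇒< (length (suffix (entry i) u)) (length (suffix (entry i) v)) p))))
      (λ p → ℕ.<⇒<ᵇ (unlengths i u v (ℕ.∸-monoʳ-< (ℕ.<ᵇ⇒< (toℕ v) (toℕ u) p) (ℕ.<⇒≤ (toℕ<n u)))))
    where
    lengths : ∀ i u v → length (suffix (entry i) u) < length (suffix (entry i) v) →
      count i ∸ toℕ u < count i ∸ toℕ v
    lengths i u v p rewrite length-suffix (entry i) u | length-suffix (entry i) v = p
    unlengths : ∀ i u v → count i ∸ toℕ u < count i ∸ toℕ v →
      length (suffix (entry i) u) < length (suffix (entry i) v)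
    unlengths i u v p rewrite length-suffix (entry i) u | length-suffix (entry i) v = p

  notLaterᵗ : point ×ᵗ point ⟶ bool
  notLaterᵗ = notᵗ laterᵗ

  sameᵗ : point ×ᵗ point ⟶ bool
  sameᵗ = extensional (notLaterᵗ ∧ᵗ (⟨ snd , fst ⟩ ⨟ notLaterᵗ)) (λ _ (u , v) → does (u ≟ v))
    λ i (u , v) → T-ext _ _
      (λ p → let u≤v , v≤u = ∧-elim (not (toℕ v <ᵇ toℕ u)) p in
        does-complete (u ≟ v) (toℕ-injective (ℕ.≤-antisym
          (ℕ.≮⇒≥ (not-elim _ u≤v ∘ ℕ.<⇒<ᵇ)) (ℕ.≮⇒≥ (not-elim _ v≤u ∘ ℕ.<⇒<ᵇ)))))
      (λ p → let eq = does-sound (u ≟ v) p in ∧-intro (not (toℕ v <ᵇ toℕ u))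
        (not-intro _ (λ q → ℕ.<-irrefl (sym (cong toℕ eq)) (ℕ.<ᵇ⇒< (toℕ v) (toℕ u) q)))
        (not-intro _ (λ q → ℕ.<-irrefl (cong toℕ eq) (ℕ.<ᵇ⇒< (toℕ u) (toℕ v) q))))

-- Vacuously true at `nothing`: a threshold at infinity is in order with every other end and
-- contradicts no claim about `d`.
bothJust : A ×ᵗ B ⟶ bool → maybeᵗ A ×ᵗ maybeᵗ B ⟶ bool
bothJust p = caseMaybe trueᵗ (⟨ snd , fst ⟩ ⨟ caseMaybe trueᵗ (⟨ snd , fst ⟩ ⨟ p))

product : Γ ⟶ list A → Γ ⟶ list B → Γ ⟶ list (A ×ᵗ B)
product as bs = concatMapᵗ as (mapᵗ (fst ⨟ bs) ⟨ fst ⨟ snd , snd ⟩)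

∈-product : ∀ (as : Γ ⟶ list A) (bs : Γ ⟶ list B) i γ {x y} →
  x ∈ˡ fun as i γ → y ∈ˡ fun bs i γ → (x , y) ∈ˡ fun (product as bs) i γ
∈-product as bs i γ x∈ y∈ = ∈-concatMap⁺ _ (Any.map (λ { refl → ∈-map⁺ _ y∈ }) x∈)

allᵗ-spec : ∀ (as : Γ ⟶ list A) (p : Γ ×ᵗ A ⟶ bool) i γ →
  T (fun (allᵗ as p) i γ) ⇔ (∀ x → x ∈ˡ fun as i γ → T (fun p i (γ , x)))
allᵗ-spec as p i γ = mk⇔
  (λ h x x∈ → All.lookup (all⁺ (λ x → fun p i (γ , x)) (fun as i γ) h) x∈)
  (λ h → all⁻ (λ x → fun p i (γ , x)) (All.tabulate λ {x} → h x))

opaque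

  tuples : ∀ m → Γ ⟶ list A → Γ ⟶ list (vec m A)
  tuples zero    as = constant (node leaf leaf) (λ _ → [ [] ]) (λ _ → refl)
  tuples (suc m) as = concatMapᵗ as (mapᵗ (fst ⨟ tuples m as)
    (⟨ fst ⨟ snd , snd ⟩ ⨟ retype (λ _ (x , xs) → x ∷ xs) (λ _ _ → refl)))

  ∈-tuples : ∀ {m} (as : Γ ⟶ list A) i γ (xs : Vec (Carrier A i) m) →
    (∀ x → x ∈ˡ fun as i γ) → xs ∈ˡ fun (tuples m as) i γ
  ∈-tuples as i γ []       all∈ = here refl
  ∈-tuples as i γ (x ∷ xs) all∈ =
    ∈-concatMap⁺ _ (Any.map (λ { refl → ∈-map⁺ _ (∈-tuples as i γ xs all∈) }) (all∈ x))

-- Thresholds, cells and agreement of labels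

module Encoding (t : ℕ) where

  Input : Set
  Input = ∃ (Representation t) × ℕ

  -- The instance is the index, so that the types of vertices and positions can depend on it; hence
  -- `input` has a trivial carrier but the whole instance as its encoding.
  raw input : Ty Input
  raw .Carrier _ = MultiInterval t
  raw .enc _     = encFamily encInterval ∘ MultiInterval.interval
  input .Carrier _               = ⊤
  input .enc ((n , F) , k) _     = node (encRepresentation F) (encParam k)

  order parameter : Input → ℕ
  order ((n , F) , k)     = n
  parameter ((n , F) , k) = k

  rep : ∀ i → Fin (order i) → MultiInterval t
  rep ((n , F) , k) = F

  module V = Points {A = raw} order rep
  module P = Points {A = unit} parameter (λ _ _ → tt)

  vertex pos atom cell : Ty Input
  vertex = V.point
  pos    = P.point
  -- `nothing` is a threshold at infinity: −∞ as the lower end of a cell, +∞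
  -- as its upper end.
  atom   = maybeᵗ (pos ×ᵗ vertex)
  cell   = atom ×ᵗ atom

  components : input ⟶ list raw ×ᵗ nat
  components = retype (λ ((n , F) , k) _ → tabulate F , k) (λ _ _ → refl)

  vertices : input ⟶ list vertex
  vertices = V.points (components ⨟ fst) (λ _ _ → refl)

  parameterᵗ : input ⟶ nat
  parameterᵗ = components ⨟ snd

  positions : input ⟶ list pos
  positions = P.points
    (recode parameterᵗ (λ i _ → tabulate {n = parameter i} (λ _ → tt)) (λ i _ → lemma i (parameter i)))
    (λ _ _ → refl)
    where
    lemma : ∀ i k → enc (list unit) i (tabulate {n = k} (λ _ → tt)) ≡ encParam k
    lemma i zero    = refl
    lemma i (suc k) = cong (node leaf) (lemma i k)

  atoms : input ⟶ list atom
  atoms = nothingᵗ ∷ᵗ mapᵗ (product positions vertices) (justᵗ snd)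

  ∈-atoms : ∀ i a → a ∈ˡ fun atoms i tt
  ∈-atoms i nothing        = here refl
  ∈-atoms i (just (p , v)) =
    there (∈-map⁺ just (∈-product positions vertices i tt (∈-allFin p) (∈-allFin v)))

  cells : input ⟶ list cell
  cells = product atoms atoms

  ∈-cells : ∀ i c → c ∈ˡ fun cells i tt
  ∈-cells i (a , b) = ∈-product atoms atoms i tt (∈-atoms i a) (∈-atoms i b)

  -- A family of thresholds, one for each vertex u, linearly preordered by
  -- `below`; `above (u , v)` says that v lies beyond the threshold of u.
  record Slot : Set where
    field
      below above : vertex ×ᵗ vertex ⟶ bool
      total       : ∀ i u v → T (fun below i (u , v)) ⊎ T (fun below i (v , u))
      transitive  : ∀ i {u v w} →
        T (fun below i (u , v)) → T (fun below i (v , w)) → T (fun below i (u , w))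
      above-mono  : ∀ i {u v w} →
        T (fun below i (u , v)) → T (fun above i (v , w)) → T (fun above i (u , w))

  module _ (s : Slot) where
    open Slot s

    -- Negating the swapped comparison makes it strict. With tied ends the region would be empty,
    -- and a label could meet its claim vacuously.
    ordered : cell ⟶ bool
    ordered = bothJust (notᵗ (⟨ snd ⨟ snd , fst ⨟ snd ⟩ ⨟ below))

    inCell : vertex ×ᵗ cell ⟶ bool
    inCell = (⟨ fst , snd ⨟ fst ⟩ ⨟ caseMaybe trueᵗ (⟨ snd ⨟ snd , fst ⟩ ⨟ above))
           ∧ᵗ (⟨ fst , snd ⨟ snd ⟩ ⨟ caseMaybe trueᵗ (notᵗ (⟨ snd ⨟ snd , fst ⟩ ⨟ above)))

  allOrdered : (ss : List Slot) → vec (length ss) cell ⟶ bool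
  allOrdered []       = trueᵗ
  allOrdered (s ∷ ss) = (headᵗ ⨟ ordered s) ∧ᵗ (tailᵛ ⨟ allOrdered ss)

  inCells : (ss : List Slot) → vertex ×ᵗ vec (length ss) cell ⟶ bool
  inCells []       = trueᵗ
  inCells (s ∷ ss) = (⟨ fst , snd ⨟ headᵗ ⟩ ⨟ inCell s) ∧ᵗ (⟨ fst , snd ⨟ tailᵛ ⟩ ⨟ inCells ss)

  samePosition : atom ×ᵗ atom ⟶ bool
  samePosition = caseMaybe (⟨ unitᵗ , idᵗ ⟩ ⨟ caseMaybe {Γ = unit} trueᵗ falseᵗ)
    (⟨ snd ⨟ fst , fst ⟩ ⨟ caseMaybe falseᵗ (⟨ snd ⨟ fst , fst ⟩ ⨟ P.sameᵗ))

  -- Equal positions with equal vertices make `d` a function; different positions with different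
  -- vertices make it injective.
  agree : atom ×ᵗ atom ⟶ bool
  agree = bothJust (ifᵗ (⟨ fst ⨟ fst , snd ⨟ fst ⟩ ⨟ P.sameᵗ) same (notᵗ same))
    where
    same : (pos ×ᵗ vertex) ×ᵗ (pos ×ᵗ vertex) ⟶ bool
    same = ⟨ fst ⨟ snd , snd ⨟ snd ⟩ ⨟ V.sameᵗ

  agreeCells : cell ×ᵗ cell ⟶ bool
  agreeCells = ((⟨ fst ⨟ fst , snd ⨟ fst ⟩ ⨟ agree) ∧ᵗ (⟨ fst ⨟ fst , snd ⨟ snd ⟩ ⨟ agree))
             ∧ᵗ ((⟨ fst ⨟ snd , snd ⨟ fst ⟩ ⨟ agree) ∧ᵗ (⟨ fst ⨟ snd , snd ⨟ snd ⟩ ⨟ agree))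

  positionOf : ∀ {k} {X : Set} → Maybe (Fin k × X) → Fin (suc k)
  positionOf nothing        = zero
  positionOf (just (p , _)) = suc p

  keys : ∀ {m k} {X : Set} → Vec (Maybe (Fin k × X) × Maybe (Fin k × X)) m → Vec (Fin (suc k)) m
  keys = Vec.map (positionOf ∘ proj₁)

  samePosition-spec : ∀ i a b → T (fun samePosition i (a , b)) ⇔ positionOf a ≡ positionOf b
  samePosition-spec i nothing        nothing        = mk⇔ (λ _ → refl) _
  samePosition-spec i nothing        (just _)       = mk⇔ (λ ()) (λ ())
  samePosition-spec i (just _)       nothing        = mk⇔ (λ ()) (λ ())
  samePosition-spec i (just (p , _)) (just (q , _)) =
    mk⇔ (cong suc ∘ does-sound (p ≟ q)) (does-complete (p ≟ q) ∘ suc-injective)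

  opaque

    sameKey : ∀ m → vec m cell ×ᵗ vec m cell ⟶ bool
    sameKey zero    = trueᵗ
    sameKey (suc m) = (⟨ fst ⨟ headᵗ ⨟ fst , snd ⨟ headᵗ ⨟ fst ⟩ ⨟ samePosition)
                    ∧ᵗ (⟨ fst ⨟ tailᵛ , snd ⨟ tailᵛ ⟩ ⨟ sameKey m)

    sameKey-spec : ∀ {m} i xs ys → T (fun (sameKey m) i (xs , ys)) ⇔ keys xs ≡ keys ys
    sameKey-spec i []             []             = mk⇔ (λ _ → refl) _
    sameKey-spec i ((a , _) ∷ xs) ((b , _) ∷ ys) = mk⇔
      (λ p → let q , r = ∧-elim (fun samePosition i (a , b)) p
             in cong₂ _∷_ (to (samePosition-spec i a b) q) (to (sameKey-spec i xs ys) r))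
      (λ eq → ∧-intro (fun samePosition i (a , b))
         (from (samePosition-spec i a b) (Vec.∷-injectiveˡ eq))
         (from (sameKey-spec i xs ys) (Vec.∷-injectiveʳ eq)))
  
  agree-spec : ∀ i p u q v → T (fun agree i (just (p , u) , just (q , v))) ⇔ (p ≡ q ⇔ u ≡ v)
  agree-spec i p u q v with p ≟ q | u ≟ v
  ... | yes p≡q | yes u≡v = mk⇔ (λ _ → mk⇔ (λ _ → u≡v) (λ _ → p≡q)) _
  ... | yes p≡q | no  u≢v = mk⇔ (λ ()) (λ h → ⊥-elim (u≢v (to h p≡q)))
  ... | no  p≢q | yes u≡v = mk⇔ (λ ()) (λ h → ⊥-elim (p≢q (from h u≡v)))
  ... | no  p≢q | no  u≢v = mk⇔ (λ _ → mk⇔ (⊥-elim ∘ p≢q) (⊥-elim ∘ u≢v)) _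

  side : {X : Set} → Bool → X × X → X
  side false = proj₁
  side true  = proj₂

  agreeCells-spec : ∀ i c c′ →
    T (fun agreeCells i (c , c′)) ⇔ (∀ l r → T (fun agree i (side l c , side r c′)))
  agreeCells-spec i c c′ = mk⇔
    (λ p → let p₁ , p₂ = ∧-elim (f false false ∧ f false true) p
               p₃ , p₄ = ∧-elim (f false false) p₁
               p₅ , p₆ = ∧-elim (f true false) p₂
           in λ { false false → p₃ ; false true → p₄ ; true false → p₅ ; true true → p₆ })
    (λ h → ∧-intro (f false false ∧ f false true)
             (∧-intro (f false false) (h false false) (h false true))
             (∧-intro (f true false) (h true false) (h true true)))
    where
    f : Bool → Bool → Bool
    f l r = fun agree i (side l c , side r c′)

  opaque

    -- Also applied to a label and itself, where it excludes internal contradictions.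
    linked : ∀ {m} → vec m cell ×ᵗ vec m cell ⟶ bool
    linked = allᵗ (fst ⨟ toListᵗ) (allᵗ (fst ⨟ snd ⨟ toListᵗ) (⟨ fst ⨟ snd , snd ⟩ ⨟ agreeCells))

    linked-spec : ∀ {m} i (xs ys : Vec (Carrier cell i) m) →
      T (fun linked i (xs , ys)) ⇔
      (∀ c c′ → c ∈ˡ Vec.toList xs → c′ ∈ˡ Vec.toList ys → ∀ l r →
        T (fun agree i (side l c , side r c′)))
    linked-spec i xs ys = mk⇔
      (λ p c c′ c∈ c′∈ → to (agreeCells-spec i c c′)
        (All.lookup (all⁺ (λ c′ → fun agreeCells i (c , c′)) (Vec.toList ys)
          (All.lookup (all⁺ agreesWithAll (Vec.toList xs) p) c∈)) c′∈))
      (λ h → all⁻ agreesWithAll (All.tabulate λ {c} c∈ →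
        all⁻ (λ c′ → fun agreeCells i (c , c′)) (All.tabulate λ {c′} c′∈ →
          from (agreeCells-spec i c c′) (h c c′ c∈ c′∈))))
      where
      agreesWithAll : Carrier cell i → Bool
      agreesWithAll c = all (λ c′ → fun agreeCells i (c , c′)) (Vec.toList ys)

  oneWay : ∀ {m} → vec m cell ×ᵗ vec m cell ⟶ bool
  oneWay {m} = notᵗ (sameKey m) ∧ᵗ linked

  oneWay-spec : ∀ {m} i (xs ys : Vec (Carrier cell i) m) →
    T (fun oneWay i (xs , ys)) ⇔ (keys xs ≢ keys ys × T (fun linked i (xs , ys)))
  oneWay-spec {m} i xs ys = mk⇔
    (λ p → let p₁ , p₂ = to spec p
           in (not-elim (fun (sameKey m) i (xs , ys)) p₁ ∘ from (sameKey-spec i xs ys)) , p₂)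
    (λ (p₁ , p₂) → from spec (not-intro (fun (sameKey m) i (xs , ys)) (p₁ ∘ to (sameKey-spec i xs ys)) , p₂))
    where
    spec = ∧ᵗ-spec (notᵗ (sameKey m)) linked i (xs , ys)

  opaque

    -- Symmetrised by a conjunction, so that symmetry of the graph is just commutativity of `∧`.
    edge : ∀ {m} → vec m cell ×ᵗ vec m cell ⟶ bool
    edge = oneWay ∧ᵗ (⟨ snd , fst ⟩ ⨟ oneWay)

    edge-sym : ∀ {m} i (xs ys : Vec (Carrier cell i) m) →
      fun edge i (xs , ys) ≡ fun edge i (ys , xs)
    edge-sym i xs ys = ∧-comm (fun oneWay i (xs , ys)) (fun oneWay i (ys , xs))

    edge⇒oneWay : ∀ {m} i (xs ys : Vec (Carrier cell i) m) →
      T (fun edge i (xs , ys)) → T (fun oneWay i (xs , ys))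
    edge⇒oneWay i xs ys = proj₁ ∘ ∧-elim (fun oneWay i (xs , ys))

    oneWay⇒edge : ∀ {m} i (xs ys : Vec (Carrier cell i) m) →
      T (fun oneWay i (xs , ys)) → T (fun oneWay i (ys , xs)) → T (fun edge i (xs , ys))
    oneWay⇒edge i xs ys = ∧-intro (fun oneWay i (xs , ys))

  at : ∀ {k} {X : Set} → (Fin k → X) → Fin (suc k) → Maybe (Fin k × X)
  at d zero    = nothing
  at d (suc p) = just (p , d p)

  -- These are the labels that are truthful about `d`; `reassemble` brings every truthful label into
  -- this form.
  assemble : ∀ {m k} {X : Set} → (Fin k → X) → (ps qs : Vec (Fin (suc k)) m) →
    Vec (Maybe (Fin k × X) × Maybe (Fin k × X)) m
  assemble d = Vec.zipWith (λ p q → at d p , at d q)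

  positionOf-at : ∀ {k} {X : Set} (d : Fin k → X) p → positionOf (at d p) ≡ p
  positionOf-at d zero    = refl
  positionOf-at d (suc p) = refl

  keys-assemble : ∀ {m k} {X : Set} (d : Fin k → X) (ps qs : Vec (Fin (suc k)) m) →
    keys (assemble d ps qs) ≡ ps
  keys-assemble d []       []       = refl
  keys-assemble d (p ∷ ps) (q ∷ qs) = cong₂ _∷_ (positionOf-at d p) (keys-assemble d ps qs)

  ∈-assemble : ∀ {m k} {X : Set} (d : Fin k → X) (ps qs : Vec (Fin (suc k)) m) {c} →
    c ∈ˡ Vec.toList (assemble d ps qs) → ∀ l → ∃[ p ] side l c ≡ at d p
  ∈-assemble d [] [] ()
  ∈-assemble d (p ∷ ps) (q ∷ qs) (here refl) false = p , refl
  ∈-assemble d (p ∷ ps) (q ∷ qs) (here refl) true  = q , refl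
  ∈-assemble d (p ∷ ps) (q ∷ qs) (there c∈)  l     = ∈-assemble d ps qs c∈ l

  linked-assemble : ∀ {m} i {d : Fin (parameter i) → Fin (order i)} → Injective _≡_ _≡_ d →
    (ps qs ps′ qs′ : Vec (Fin (suc (parameter i))) m) →
    T (fun linked i (assemble d ps qs , assemble d ps′ qs′))
  linked-assemble i {d} d-inj ps qs ps′ qs′ = from (linked-spec i _ _) λ c c′ c∈ c′∈ l r →
    let p , eq = ∈-assemble d ps qs c∈ l
        q , eq′ = ∈-assemble d ps′ qs′ c′∈ r
    in subst (λ (a , b) → T (fun agree i (a , b))) (sym (cong₂ _,_ eq eq′)) (agree-at p q)
    where
    agree-at : ∀ p q → T (fun agree i (at d p , at d q))
    agree-at zero    zero    = _
    agree-at zero    (suc q) = _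
    agree-at (suc p) zero    = _
    agree-at (suc p) (suc q) = from (agree-spec i p (d p) q (d q)) (mk⇔ (cong d) d-inj)

⇒-elim : ∀ a {b} → T (not a ∨ b) → T a → T b
⇒-elim true q _ = q

⇒-intro : ∀ a {b} → (T a → T b) → T (not a ∨ b)
⇒-intro true  f = f _
⇒-intro false f = _

-- Graph classes and vertex set properties open to the reduction

module Problem (t : ℕ) where
  open Encoding t public

  -- The essential field is `determined`: whether `d` dominates a vertex depends only on which of
  -- the thresholds of `d` the vertex lies beyond, so it is constant on cells.
  record GraphKind : Set₁ where
    field
      toGraph       : ∀ {n} → Representation t n → Graph n
      adjacent      : vertex ×ᵗ vertex ⟶ bool
      adjacent-spec : ∀ i u v → T (fun adjacent i (u , v)) ⇔ Graph._~_ (toGraph (rep i)) u v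
      slots         : List Slot

    graph : ∀ i → Graph (order i)
    graph i = toGraph (rep i)

    closed : vertex ×ᵗ vertex ⟶ bool
    closed = V.sameᵗ ∨ᵗ adjacent

    field
      determined : ∀ i d v v′ →
        (∀ {s} → s ∈ˡ slots → fun (Slot.above s) i (d , v) ≡ fun (Slot.above s) i (d , v′)) →
        T (fun closed i (v , d)) → T (fun closed i (v′ , d))

  module _ (kind : GraphKind) (Property : VertexSetProperty) where
    open GraphKind kind

    -- A property of sets of k vertices must be expressible by a condition on
    -- any two listed vertices and a third one (or `nothing`) that is guessed
    -- for them; this is what fits into a single vertex of the clique instance.
    record Test : Set₁ where
      field
        check : (pos ×ᵗ vertex) ×ᵗ ((pos ×ᵗ vertex) ×ᵗ atom) ⟶ bool

      Passes : ∀ i → (Fin (parameter i) → Fin (order i)) → Set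
      Passes i d = ∀ a b → ∃[ c ] T (fun check i ((a , d a) , ((b , d b) , at d c)))

      field
        complete : ∀ i {D} → ∣ D ∣ ≡ parameter i → Property (graph i) D →
          ∃[ d ] d Lists D × IsDominating (graph i) D × Passes i d
        sound    : ∀ i {d D} → d Lists D → IsDominating (graph i) D → Passes i d →
          Property (graph i) D

  -- The cells cut out by a listing

  module Marked (i : Input) (d : Fin (parameter i) → Fin (order i)) where

    Marks : ℕ → Set
    Marks = Vec (Fin (suc (parameter i)))

    module _ (s : Slot) where
      open Slot s

      -- The index `zero` is the lower end at minus infinity, which has no threshold at or below it.
      Below : Fin (parameter i) → Fin (suc (parameter i)) → Set
      Below j zero    = ⊥
      Below j (suc m) = T (fun below i (d j , d m))

      below? : ∀ j p → Dec (Below j p)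
      below? j zero    = no λ ()
      below? j (suc m) = T? _

      -- Take the highest threshold of `d` that `v` lies beyond, or minus infinity. By maximality
      -- `v` lies beyond none that is strictly higher, so it stays inside whichever admissible upper
      -- end is guessed.
      lower : ∀ v → ∃[ p ] ∀ q → T (fun (ordered s) i (at d p , at d q)) →
        T (fun (inCell s) i (v , (at d p , at d q)))
      lower v with maximum {P = λ j → T (fun above i (d j , v))}
        (λ j m → T (fun below i (d j , d m))) (λ j m → total i (d j) (d m)) (transitive i) (λ j → T? _)
      ... | inj₂ none = zero , λ { zero _ → _ ; (suc q) _ → not-intro _ (none q) }
      ... | inj₁ (m , m-above , max) = suc m ,
        λ { zero    _   → ∧-intro (fun above i (d m , v)) m-above _
          ; (suc q) ord → ∧-intro (fun above i (d m , v)) m-above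
                            (not-intro _ (not-elim (fun below i (d q , d m)) ord ∘ max)) }

      -- Take the next threshold, the lowest one not below `p`, or plus infinity. A vertex in
      -- between lies beyond exactly the thresholds at or below `p`, so all of them compare alike
      -- with `d`.
      upper : ∀ p → ∃[ q ] T (fun (ordered s) i (at d p , at d q)) ×
        (∀ {v j} → T (fun (inCell s) i (v , (at d p , at d q))) →
          T (fun above i (d j , v)) ⇔ Below j p)
      upper p with maximum {P = λ j → ¬ Below j p}
        (λ j m → T (fun below i (d m , d j))) (λ j m → total i (d m) (d j))
        (λ j⊑m m⊑l → transitive i m⊑l j⊑m) (λ j → ¬? (below? j p))
      ... | inj₂ all-below = zero , ordered-zero p , λ {v} {j} inside →
        mk⇔ (λ _ → decidable-stable (below? j p) (all-below j)) (below⇒above p inside)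
        where
        ordered-zero : ∀ p → T (fun (ordered s) i (at d p , nothing))
        ordered-zero p = _
        below⇒above : ∀ p {v j} → T (fun (inCell s) i (v , (at d p , nothing))) → Below j p →
          T (fun above i (d j , v))
        below⇒above (suc m) {v} inside j⊑m =
          above-mono i j⊑m (proj₁ (∧-elim (fun above i (d m , v)) inside))
      ... | inj₁ (m , m-not-below , min) = suc m , ordered-suc p m-not-below , λ {v} {j} inside →
        mk⇔ (λ j-above → decidable-stable (below? j p) λ j-not-below →
               not-above p inside (above-mono i (min j-not-below) j-above))
            (below⇒above p inside)
        where
        ordered-suc : ∀ p → ¬ Below m p → T (fun (ordered s) i (at d p , at d (suc m)))
        ordered-suc zero    _ = _
        ordered-suc (suc _) h = not-intro _ h
        not-above : ∀ p {v} → T (fun (inCell s) i (v , (at d p , at d (suc m)))) →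
          ¬ T (fun above i (d m , v))
        not-above zero        inside = not-elim _ inside
        not-above (suc l) {v} inside = not-elim _ (proj₂ (∧-elim (fun above i (d l , v)) inside))
        below⇒above : ∀ p {v j} → T (fun (inCell s) i (v , (at d p , at d (suc m)))) → Below j p →
          T (fun above i (d j , v))
        below⇒above (suc l) {v} inside j⊑l =
          above-mono i j⊑l (proj₁ (∧-elim (fun above i (d l , v)) inside))

    lowers : ∀ ss v → Σ[ ps ∈ Marks (length ss) ] ∀ qs →
      T (fun (allOrdered ss) i (assemble d ps qs)) → T (fun (inCells ss) i (v , assemble d ps qs))
    lowers []       v = [] , λ { [] _ → _ }
    lowers (s ∷ ss) v =
      let p , inside = lower s v
          ps , insides = lowers ss v
      in p ∷ ps , λ { (q ∷ qs) ord →
           let ord₁ , ord₂ = ∧-elim (fun (ordered s) i (at d p , at d q)) ord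
           in ∧-intro (fun (inCell s) i (v , (at d p , at d q))) (inside q ord₁) (insides qs ord₂) }

    uppers : ∀ ss (ps : Marks (length ss)) → Σ[ qs ∈ Marks (length ss) ]
      T (fun (allOrdered ss) i (assemble d ps qs)) ×
      (∀ {v v′} → T (fun (inCells ss) i (v , assemble d ps qs)) →
        T (fun (inCells ss) i (v′ , assemble d ps qs)) →
        ∀ {s} → s ∈ˡ ss → ∀ j → fun (Slot.above s) i (d j , v) ≡ fun (Slot.above s) i (d j , v′))
    uppers []       []       = [] , _ , λ _ _ ()
    uppers (s ∷ ss) (p ∷ ps) =
      let q , ord , spec = upper s p
          qs , ords , specs = uppers ss ps
      in q ∷ qs , ∧-intro (fun (ordered s) i (at d p , at d q)) ord ords ,
         λ {v} {v′} inside inside′ →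
           let in₁ , in₂   = ∧-elim (fun (inCell s) i (v , (at d p , at d q))) inside
               in₁′ , in₂′ = ∧-elim (fun (inCell s) i (v′ , (at d p , at d q))) inside′
           in λ { (here refl) j → T-ext _ _ (from (spec in₁′) ∘ to (spec in₁))
                                            (from (spec in₁) ∘ to (spec in₁′))
                ; (there s∈)  j → specs in₂ in₂′ s∈ j }

-- The reduction

powPoly : Poly → ℕ → Poly
powPoly p zero    = const 1
powPoly p (suc m) = p ⊗ powPoly p m

⟦powPoly⟧ : ∀ p m n → ⟦ powPoly p m ⟧ n ≡ ⟦ p ⟧ n ^ m
⟦powPoly⟧ p zero    n = refl
⟦powPoly⟧ p (suc m) n = cong (⟦ p ⟧ n *_) (⟦powPoly⟧ p m n)

size-encParam : ∀ k → size (encParam k) ≡ 1 + 2 * k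
size-encParam zero    = refl
size-encParam (suc k) = trans (cong (2 +_) (size-encParam k))
  (solve 1 (λ k → con 2 :+ (con 1 :+ con 2 :* k) := con 1 :+ con 2 :* (con 1 :+ k)) refl k)
  where open +-*-Solver

instanceᵗ : ParamProblem → Ty I
instanceᵗ P .Carrier _       = ParamProblem.Instance P × ℕ
instanceᵗ P .enc _ (x , k)   = node (ParamProblem.encode P x) (encParam k)

-- All information is in the index.
queryᵗ : (P : ParamProblem) → Ty (ParamProblem.Instance P × ℕ)
queryᵗ P .Carrier _     = ⊤
queryᵗ P .enc (x , k) _ = node (ParamProblem.encode P x) (encParam k)

module _ {P Q : ParamProblem} (f : queryᵗ P ⟶ instanceᵗ Q) (h : Poly) where

  private
    module P = ParamProblem P
    module Q = ParamProblem Q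

  -- If the encoded representation has size s, the input has size 1 + s + (1 + 2k), which is at most
  -- (2k + 3)s because s is positive; `⟦⟧-separate` then splits the factors.
  timeBound : Poly
  timeBound = cost f after (const 2 ⊗ var ⊕ const 3)

  time-≤ : ∀ s k .{{_ : NonZero s}} →
    ⟦ cost f ⟧ (1 + s + size (encParam k)) ≤ ⟦ timeBound ⟧ k * s ^ degree (cost f)
  time-≤ s k = begin
    ⟦ cost f ⟧ (1 + s + size (encParam k))
      ≤⟨ ⟦⟧-mono (cost f) input-≤ ⟩
    ⟦ cost f ⟧ ((2 * k + 3) * s)
      ≤⟨ ⟦⟧-separate (cost f) (2 * k + 3) s ⟩
    ⟦ cost f ⟧ (2 * k + 3) * s ^ degree (cost f)
      ≡⟨ cong (_* s ^ degree (cost f)) (⟦after⟧ (cost f) (const 2 ⊗ var ⊕ const 3) k) ⟨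
    ⟦ timeBound ⟧ k * s ^ degree (cost f) ∎
    where
    open ℕ.≤-Reasoning
    open +-*-Solver using (solve; con; _:+_; _:*_; _:=_)
    input-≤ : 1 + s + size (encParam k) ≤ (2 * k + 3) * s
    input-≤ = begin
      1 + s + size (encParam k) ≡⟨ cong (1 + s +_) (size-encParam k) ⟩
      1 + s + (1 + 2 * k)       ≡⟨ solve 2 (λ s k → con 1 :+ s :+ (con 1 :+ con 2 :* k)
                                     := (con 2 :* k :+ con 2) :+ s) refl s k ⟩
      (2 * k + 2) + s           ≤⟨ ℕ.+-monoˡ-≤ s (ℕ.m≤m*n (2 * k + 2) s) ⟩
      (2 * k + 2) * s + s       ≡⟨ solve 2 (λ s k → (con 2 :* k :+ con 2) :* s :+ s
                                     := (con 2 :* k :+ con 3) :* s) refl s k ⟩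
      (2 * k + 3) * s           ∎

  polynomialReduction : (∀ x k → proj₂ (fun f (x , k) tt) ≤ ⟦ h ⟧ k) →
    (∀ x k → P.Yes x k ⇔ Q.Yes (proj₁ (fun f (x , k) tt)) (proj₂ (fun f (x , k) tt))) →
    FPTReduction P Q
  polynomialReduction k′≤ correct = record
    { g            = ⟦ timeBound ⟧
    ; h            = ⟦ h ⟧
    ; g-computable = computable timeBound
    ; h-computable = computable h
    ; exponent     = degree (cost f)
    ; program      = prog f
    ; reduces      = λ x k →
        let x′ , k′          = fun f (x , k) tt
            time , run , t≤ = runs f (x , k) tt
        in x′ , k′ , time , run ,
           ℕ.≤-trans t≤ (time-≤ (size (P.encode x)) k {{>-nonZero (size≥1 (P.encode x))}}) ,
           k′≤ x k , correct x k
    }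

encFamily-lookup : {X Y Z : Set} (e : Y → Tree) (e′ : Z → Tree) (f : X → Y) (f′ : X → Z) →
  (∀ x → e (f x) ≡ e′ (f′ x)) → (xs : List X) → encFamily e (f ∘ lookup xs) ≡ encList e′ (List.map f′ xs)
encFamily-lookup e e′ f f′ eq []       = refl
encFamily-lookup e e′ f f′ eq (x ∷ xs) = cong₂ node (eq x) (encFamily-lookup e e′ f f′ eq xs)

-- A vertex of the graph produced by the reduction is a vector of pairs of
-- atoms: the positions of the first components are its key, the second
-- components are guessed. The vertex (a , w) ∷ (b , c) ∷ cells claims that w
-- dominates all vertices lying in the cells, and that a, b, c pass the test.
module Reduction (t : ℕ) (kind : Problem.GraphKind t) (Property : VertexSetProperty)
  (test : Problem.Test t kind Property) where

  open Problem t
  open GraphKind kind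
  open Test test

  arity : ℕ
  arity = 2 + length slots

  label : Ty Input
  label = vec arity cell

  cellsᵗ : label ⟶ vec (length slots) cell
  cellsᵗ = tailᵛ ⨟ tailᵛ

  -- The test concerns two listed vertices; a key that lacks one of them passes by default.
  passesᵗ : label ⟶ bool
  passesᵗ = ⟨ ⟨ tailᵛ ⨟ headᵗ ⨟ snd , headᵗ ⨟ fst ⟩ , tailᵛ ⨟ headᵗ ⨟ fst ⟩
          ⨟ caseMaybe trueᵗ (⟨ ⟨ fst ⨟ fst , snd ⟩ , fst ⨟ snd ⟩
          ⨟ caseMaybe trueᵗ (⟨ snd , ⟨ fst ⨟ snd , fst ⨟ fst ⟩ ⟩ ⨟ check))

  insideᵗ : vertex ×ᵗ label ⟶ bool
  insideᵗ = ⟨ fst , snd ⨟ cellsᵗ ⟩ ⨟ inCells slots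

  -- The default `false` gives `nothing` a meaning as a guess: the claim that no vertex of the input
  -- lies in the cells.
  dominatedᵗ : vertex ×ᵗ label ⟶ bool
  dominatedᵗ = ⟨ fst , snd ⨟ headᵗ ⨟ snd ⟩ ⨟ caseMaybe falseᵗ (⟨ fst , snd ⨟ snd ⟩ ⨟ closed)

  coveredᵗ : (input ×ᵗ label) ×ᵗ vertex ⟶ bool
  coveredᵗ = ⟨ snd , fst ⨟ snd ⟩ ⨟ (notᵗ insideᵗ ∨ᵗ dominatedᵗ)

  linkedᵗ orderedᵗ testedᵗ coversᵗ validᵗ : input ×ᵗ label ⟶ bool
  linkedᵗ  = ⟨ snd , snd ⟩ ⨟ linked
  orderedᵗ = snd ⨟ cellsᵗ ⨟ allOrdered slots
  testedᵗ = snd ⨟ passesᵗ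
  coversᵗ  = allᵗ (fst ⨟ vertices) coveredᵗ
  validᵗ   = linkedᵗ ∧ᵗ orderedᵗ ∧ᵗ testedᵗ ∧ᵗ coversᵗ

  labels : input ⟶ list label
  labels = filterᵗ (tuples arity cells) validᵗ

  matrix : input ⟶ list (list bool)
  matrix = mapᵗ labels (mapᵗ (fst ⨟ labels) (⟨ fst ⨟ snd , snd ⟩ ⨟ edge))

  keyCount : Poly
  keyCount = powPoly (const 1 ⊕ var) arity

  output : input ⟶ list (list bool) ×ᵗ nat
  output = ⟨ matrix , parameterᵗ ⨟ polynomial keyCount ⟩

  module _ (i : Input) where

    private
      n = order i
      k = parameter i

    open Graph (graph i) using (_~_)

    Label : Set
    Label = Carrier label i

    edge-keys : (x y : Label) → T (fun (edge {arity}) i (x , y)) → keys x ≢ keys y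
    edge-keys x y e = proj₁ (to (oneWay-spec i x y) (edge⇒oneWay i x y e))

    edge-linked : (x y : Label) → T (fun (edge {arity}) i (x , y)) → T (fun (linked {arity}) i (x , y))
    edge-linked x y e = proj₂ (to (oneWay-spec i x y) (edge⇒oneWay i x y e))

    module Clique = ListGraph {X = Label} (λ x y → fun (edge {arity}) i (x , y)) (edge-sym {arity} i)
      (λ x → code (keys x))
      (λ {x} {y} e eq → edge-keys x y e (code-injective (keys x) (keys y) eq))
      (fun labels i tt)

    closed-spec : ∀ u v → T (fun closed i (u , v)) ⇔ (u ≡ v ⊎ u ~ v)
    closed-spec u v = mk⇔
      (λ p → [ inj₁ ∘ does-sound (u ≟ v) , inj₂ ∘ to (adjacent-spec i u v) ]′ (to T-∨ p))
      (λ { (inj₁ u≡v) → from (T-∨ {does (u ≟ v)}) (inj₁ (does-complete (u ≟ v) u≡v))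
         ; (inj₂ u~v) → from (T-∨ {does (u ≟ v)}) (inj₂ (from (adjacent-spec i u v) u~v)) })

    Valid : Label → Set
    Valid x = T (fun (linked {arity}) i (x , x))
            × T (fun (allOrdered slots) i (Vec.tail (Vec.tail x)))
            × T (fun passesᵗ i x)
            × (∀ v → T (fun insideᵗ i (v , x)) → T (fun dominatedᵗ i (v , x)))

    valid-spec : ∀ x → T (fun validᵗ i (tt , x)) ⇔ Valid x
    valid-spec x = mk⇔
      (λ p → let p₁ , q₁ = to spec₁ p
                 p₂ , q₂ = to spec₂ q₁
                 p₃ , p₄ = to spec₃ q₂
             in p₁ , p₂ , p₃ , λ v → ⇒-elim (fun insideᵗ i (v , x)) (to spec₄ p₄ v (∈-allFin v)))
      (λ (p₁ , p₂ , p₃ , p₄) → from spec₁ (p₁ , from spec₂ (p₂ , from spec₃ (p₃ , from spec₄ λ v _ →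
        ⇒-intro (fun insideᵗ i (v , x)) (p₄ v)))))
      where
      spec₁ = ∧ᵗ-spec linkedᵗ (orderedᵗ ∧ᵗ testedᵗ ∧ᵗ coversᵗ) i (tt , x)
      spec₂ = ∧ᵗ-spec orderedᵗ (testedᵗ ∧ᵗ coversᵗ) i (tt , x)
      spec₃ = ∧ᵗ-spec testedᵗ coversᵗ i (tt , x)
      spec₄ = allᵗ-spec (fst ⨟ vertices) coveredᵗ i (tt , x)

    labels⇒valid : ∀ x → x ∈ˡ fun labels i tt → Valid x
    labels⇒valid x x∈ = to (valid-spec x) (proj₂ (∈-filter⁻ (λ x → T? (fun validᵗ i (tt , x)))
      {xs = fun (tuples arity cells) i tt} x∈))

    valid⇒labels : ∀ x → Valid x → x ∈ˡ fun labels i tt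
    valid⇒labels x valid = ∈-filter⁺ (λ x → T? (fun validᵗ i (tt , x)))
      (∈-tuples cells i tt x (∈-cells i)) (from (valid-spec x) valid)

    -- Halfway between solution and clique: one listing for all labels, and for each key a valid
    -- label truthful about it.
    record Certificate (d : Fin k → Fin n) : Set where
      field
        distinct : Injective _≡_ _≡_ d
        guess    : ∀ ps → ∃[ qs ] Valid (assemble d ps qs)

    module _ {d : Fin k → Fin n} where
      open Marked i d

      -- Consider the label whose key is given by the lower ends belonging to `v`: by `lowers`, `v`
      -- is inside whatever was guessed, so this label must name a dominator. The first two key
      -- entries concern only the test and are set to `zero`.
      certificate-dominates : Certificate d → ∀ v → ∃[ j ] T (fun closed i (v , d j))
      certificate-dominates cert v with lowers slots v
      ... | ps , insides with Certificate.guess cert (zero ∷ zero ∷ ps)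
      ...   | zero ∷ c ∷ qs , _ , ord , _ , dom = ⊥-elim (dom v (insides qs ord))
      ...   | suc w ∷ c ∷ qs , _ , ord , _ , dom = w , dom v (insides qs ord)

      certificate-passes : Certificate d → Passes i d
      certificate-passes cert a b with Certificate.guess cert (suc a ∷ suc b ∷ Vec.replicate _ zero)
      ... | w ∷ c ∷ qs , _ , _ , pass , _ = c , pass

      certificate : Injective _≡_ _≡_ d → (∀ v → ∃[ j ] T (fun closed i (v , d j))) →
        Passes i d → Certificate d
      certificate d-inj dominates passes = record
        { distinct = d-inj
        ; guess    = λ { (a ∷ b ∷ ps) →
            let qs , ord , same = uppers slots ps
                w , dom = dominator (assemble d ps qs) same
                c , pass = third a b
            in w ∷ c ∷ qs ,
               linked-assemble i d-inj (a ∷ b ∷ ps) (w ∷ c ∷ qs) (a ∷ b ∷ ps) (w ∷ c ∷ qs) ,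
               ord , pass {at d w} {assemble d ps qs} , dom {at d a} {at d b , at d c} }
        }
        where
        third : ∀ a b → ∃[ c ] ∀ {w cs} → T (fun passesᵗ i ((at d a , w) ∷ (at d b , at d c) ∷ cs))
        third zero    zero    = zero , _
        third zero    (suc b) = zero , _
        third (suc a) zero    = zero , _
        third (suc a) (suc b) = let c , pass = passes a b in c , pass
        dominator : ∀ cs →
          (∀ {v v′} → T (fun (inCells slots) i (v , cs)) → T (fun (inCells slots) i (v′ , cs)) →
            ∀ {s} → s ∈ˡ slots → ∀ j →
            fun (Slot.above s) i (d j , v) ≡ fun (Slot.above s) i (d j , v′)) →
          ∃[ w ] ∀ {a b} v → T (fun (inCells slots) i (v , cs)) →
            T (fun dominatedᵗ i (v , (a , at d w) ∷ b ∷ cs))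
        -- All vertices inside compare alike with `d`, so a dominator of any one of them serves for
        -- all. If there is none, no dominator is named.
        dominator cs same with any? (λ v → T? (fun (inCells slots) i (v , cs)))
        ... | no  empty = zero , λ v inside → empty (v , inside)
        ... | yes (v₀ , inside₀) =
          let w , v₀-dominated = dominates v₀
          in suc w , λ v inside →
               determined i (d w) v₀ v (λ s∈ → same inside₀ inside s∈ w) v₀-dominated

    positionOf≡suc : ∀ {p} (a : Maybe (Fin k × Fin n)) → positionOf a ≡ suc p → ∃[ u ] a ≡ just (p , u)
    positionOf≡suc (just (p , u)) refl = u , refl

    reassemble : ∀ {m} (d : Fin k → Fin n) (x : Carrier (vec m cell) i) →
      (∀ c → c ∈ˡ Vec.toList x → ∀ l → side l c ≡ at d (positionOf (side l c))) →
      x ≡ assemble d (keys x) (Vec.map (positionOf ∘ proj₂) x)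
    reassemble d []       h = refl
    reassemble d (c ∷ x) h = cong₂ _∷_ (cong₂ _,_ (h c (here refl) false) (h c (here refl) true))
      (reassemble d x λ c c∈ → h c (there c∈))

    -- The vertex `d p` is read off the label whose key entries all are `suc p`. Every chosen label
    -- is linked with that one, so all of them agree with `d`, and agreement among these labels
    -- makes `d` injective.
    choice⇒certificate : Clique.Choice → ∃[ d ] Certificate d
    choice⇒certificate choice = d , record { distinct = d-injective ; guess = guess }
      where
      open Clique.Choice choice
      chosen : Vec (Fin (suc k)) arity → Label
      chosen ps = choose (code ps)
      chosen-valid : ∀ ps → Valid (chosen ps)
      chosen-valid ps = labels⇒valid (chosen ps) (listed (code ps))
      keys-chosen : ∀ ps → keys (chosen ps) ≡ ps
      keys-chosen ps = code-injective (keys (chosen ps)) ps (keyed (code ps))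
      linked-chosen : ∀ ps qs → T (fun linked i (chosen ps , chosen qs))
      linked-chosen ps qs = cases (code ps ≟ code qs)
        where
        cases : Dec (code ps ≡ code qs) → T (fun linked i (chosen ps , chosen qs))
        -- For equal keys there is no edge to appeal to; both labels are the same one, which is
        -- linked with itself by validity.
        cases (yes eq) = subst (λ c → T (fun linked i (chosen ps , choose c))) eq (proj₁ (chosen-valid ps))
        cases (no neq) = edge-linked (chosen ps) (chosen qs) (joined neq)
      constantly : Fin k → Vec (Fin (suc k)) arity
      constantly p = Vec.replicate arity (suc p)
      first : ∀ p → ∃[ u ] proj₁ (Vec.head (chosen (constantly p))) ≡ just (p , u)
      first p = positionOf≡suc _ (trans (sym (head-keys (chosen (constantly p))))
        (cong Vec.head (keys-chosen (constantly p))))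
        where
        head-keys : ∀ x → Vec.head (keys x) ≡ positionOf (proj₁ (Vec.head x))
        head-keys (c ∷ _) = refl
      d : Fin k → Fin n
      d = proj₁ ∘ first
      head-∈ : ∀ (x : Label) → Vec.head x ∈ˡ Vec.toList x
      head-∈ (c ∷ _) = here refl
      agreeing : ∀ ps p c → c ∈ˡ Vec.toList (chosen ps) → ∀ l →
        T (fun agree i (side l c , just (p , d p)))
      agreeing ps p c c∈ l = subst (λ a → T (fun agree i (side l c , a))) (proj₂ (first p))
        (to (linked-spec i (chosen ps) (chosen (constantly p))) (linked-chosen ps (constantly p))
          c (Vec.head (chosen (constantly p))) c∈ (head-∈ (chosen (constantly p))) l false)
      marked : ∀ ps c → c ∈ˡ Vec.toList (chosen ps) → ∀ l → side l c ≡ at d (positionOf (side l c))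
      marked ps c c∈ l = lemma (side l c) λ p → agreeing ps p c c∈ l
        where
        lemma : ∀ a → (∀ p → T (fun agree i (a , just (p , d p)))) → a ≡ at d (positionOf a)
        lemma nothing        _ = refl
        lemma (just (p , u)) h = cong (λ u → just (p , u)) (to (to (agree-spec i p u p (d p)) (h p)) refl)
      d-injective : Injective _≡_ _≡_ d
      d-injective {p} {q} = from (to (agree-spec i p (d p) q (d q))
        (subst (λ a → T (fun agree i (a , just (q , d q)))) (proj₂ (first p))
          (agreeing (constantly p) q (Vec.head (chosen (constantly p)))
            (head-∈ (chosen (constantly p))) false)))
      guesses : Vec (Fin (suc k)) arity → Vec (Fin (suc k)) arity
      guesses ps = Vec.map (positionOf ∘ proj₂) (chosen ps)
      chosen≡ : ∀ ps → chosen ps ≡ assemble d ps (guesses ps)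
      chosen≡ ps = trans (reassemble d (chosen ps) (marked ps))
        (cong (λ ps′ → assemble d ps′ (guesses ps)) (keys-chosen ps))
      guess : ∀ ps → ∃[ qs ] Valid (assemble d ps qs)
      guess ps = guesses ps , subst Valid (chosen≡ ps) (chosen-valid ps)

    certificate⇒choice : ∃[ d ] Certificate d → Clique.Choice
    certificate⇒choice (d , cert) = record
      { choose = x
      ; listed = λ c → valid⇒labels (x c) (proj₂ (guess (decode c)))
      ; keyed  = λ c → trans (cong code (keys-x c)) (proj₂ (code-surjective arity c))
      ; joined = λ {c} {c′} c≢c′ → oneWay⇒edge i (x c) (x c′)
          (differ c c′ c≢c′) (differ c′ c (c≢c′ ∘ sym))
      }
      where
      open Certificate cert
      decode : Fin (suc k ^ arity) → Vec (Fin (suc k)) arity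
      decode c = proj₁ (code-surjective arity c)
      x : Fin (suc k ^ arity) → Label
      x c = assemble d (decode c) (proj₁ (guess (decode c)))
      keys-x : ∀ c → keys (x c) ≡ decode c
      keys-x c = keys-assemble d (decode c) _
      differ : ∀ c c′ → c ≢ c′ → T (fun (oneWay {arity}) i (x c , x c′))
      differ c c′ c≢c′ = from (oneWay-spec i (x c) (x c′))
        ( (λ same → c≢c′ (trans (sym (proj₂ (code-surjective arity c))) (trans
            (cong code (trans (sym (keys-x c)) (trans same (keys-x c′))))
            (proj₂ (code-surjective arity c′)))))
        , linked-assemble i distinct (decode c) _ (decode c′) _)

    yes⇒certificate : HasSetOfSize Property (graph i) k → ∃[ d ] Certificate d
    yes⇒certificate (D , ∣D∣≡k , holds) =
      let d , d-lists , dominating , passes = complete i ∣D∣≡k holds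
      in d , certificate (injective d-lists)
           (λ v → [ (λ v∈D → let j , dj≡v = exhaustive d-lists v∈D
                             in j , from (closed-spec v (d j)) (inj₁ (sym dj≡v)))
                  , (λ (u , u∈D , v~u) → let j , dj≡u = exhaustive d-lists u∈D
                             in j , from (closed-spec v (d j)) (inj₂ (subst (v ~_) (sym dj≡u) v~u)))
                  ]′ (dominating v))
           passes

    certificate⇒yes : ∃[ d ] Certificate d → HasSetOfSize Property (graph i) k
    certificate⇒yes (d , cert) = image d , lists⇒∣∣ d-lists ,
      sound i d-lists dominating (certificate-passes cert)
      where
      d-lists = image-lists (Certificate.distinct cert)
      dominating : IsDominating (graph i) (image d)
      dominating v with certificate-dominates cert v
      ... | j , dom with to (closed-spec v (d j)) dom
      ...   | inj₁ refl = inj₁ (member d-lists j)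
      ...   | inj₂ v~dj = inj₂ (d j , member d-lists j , v~dj)

    correct : HasSetOfSize Property (graph i) k ⇔ HasSetOfSize IsClique Clique.graph (suc k ^ arity)
    correct = mk⇔ (Clique.choice⇒clique ∘ certificate⇒choice ∘ yes⇒certificate)
                  (certificate⇒yes ∘ choice⇒certificate ∘ Clique.clique⇒choice)

    enc-matrix : encFamily (encFamily encBool) (Graph.adj Clique.graph) ≡
                 enc (list (list bool)) i (fun matrix i tt)
    enc-matrix = encFamily-lookup (encFamily encBool) (encList encBool)
      (λ x b → fun edge i (x , lookup L b)) (λ x → List.map (λ y → fun edge i (x , y)) L)
      (λ x → encFamily-lookup encBool encBool (λ y → fun edge i (x , y)) (λ y → fun edge i (x , y))
        (λ _ → refl) L) L
      where
      L : List Label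
      L = fun labels i tt

    output≡ : enc (list (list bool) ×ᵗ nat) i (fun output i tt) ≡
      node (encFamily (encFamily encBool) (Graph.adj Clique.graph)) (encParam (suc k ^ arity))
    output≡ = cong₂ node (sym enc-matrix) (cong encParam (⟦powPoly⟧ (const 1 ⊕ var) arity k))

  -- For the two graph kinds below this unfolds to `Property onIntervalGraphs t` and
  -- `Property onCoIntervalGraphs t`.
  problem : ParamProblem
  problem = record
    { Instance = ∃ (Representation t)
    ; encode   = λ (_ , F) → encRepresentation F
    ; Yes      = λ (_ , F) k → HasSetOfSize Property (toGraph F) k
    }

  transform : queryᵗ problem ⟶ instanceᵗ k-CLIQUE
  transform = recode (retype {B = input} (λ _ _ → tt) (λ _ _ → refl) ⨟ output)
    (λ i _ → (_ , Clique.graph i) , suc (parameter i) ^ arity) (λ i _ → sym (output≡ i))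

  reduction : FPTReduction problem k-CLIQUE
  reduction = polynomialReduction transform keyCount
    (λ F k → ℕ.≤-reflexive (sym (⟦powPoly⟧ (const 1 ⊕ var) arity k)))
    (λ F k → correct (F , k))

-- Interval graphs

≤ℤᵇ-total : ∀ x y → T (x ≤ℤᵇ y) ⊎ T (y ≤ℤᵇ x)
≤ℤᵇ-total x y = Sum.map ≤ℤᵇ-complete ≤ℤᵇ-complete (ℤ.≤-total x y)

≤ℤᵇ-trans : ∀ x y z → T (x ≤ℤᵇ y) → T (y ≤ℤᵇ z) → T (x ≤ℤᵇ z)
≤ℤᵇ-trans x y z p q = ≤ℤᵇ-complete (ℤ.≤-trans (≤ℤᵇ-sound x y p) (≤ℤᵇ-sound y z q))

-- The disjunction is written out in the program, which is possible because `m` will be the constant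
-- `t`.
anyFin : ∀ m → (Fin m → Γ ⟶ bool) → Γ ⟶ bool
anyFin zero    f = falseᵗ
anyFin (suc m) f = f zero ∨ᵗ anyFin m (f ∘ suc)

anyFin-spec : ∀ m (f : Fin m → Γ ⟶ bool) i γ →
  T (fun (anyFin m f) i γ) ⇔ (∃[ j ] T (fun (f j) i γ))
anyFin-spec zero    f i γ = mk⇔ (λ ()) (λ ())
anyFin-spec (suc m) f i γ = mk⇔
  (λ p → [ (λ q → zero , q)
         , (λ q → let j , r = to (anyFin-spec m (f ∘ suc) i γ) q in suc j , r)
         ]′ (to (T-∨ {fun (f zero) i γ}) p))
  (λ { (zero  , q) → from (T-∨ {fun (f zero) i γ}) (inj₁ q)
     ; (suc j , q) → from (T-∨ {fun (f zero) i γ}) (inj₂ (from (anyFin-spec m (f ∘ suc) i γ) (j , q))) })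

fromℤ-mono : ∀ {x y} → x ℤ.≤ y → fromℤ x ℚ.≤ fromℤ y
fromℤ-mono x≤y = ℚ.*≤* (ℤ.*-monoʳ-≤-nonNeg (ℤ.+ 1) x≤y)

fromℤ-cancel : ∀ {x y} → fromℤ x ℚ.≤ fromℤ y → x ℤ.≤ y
fromℤ-cancel {x} {y} (ℚ.*≤* p) = ℤ.*-cancelʳ-≤-pos x y (ℤ.+ 1) p

module Intervals (t : ℕ) where
  open Problem t
  open MultiInterval using () renaming (interval to part)

  interval : Ty Input
  interval .Carrier _ = Interval
  interval .enc _     = encInterval

  endpoints : Fin t → vertex ⟶ integer ×ᵗ integer
  endpoints j = V.entryᵗ ⨟ retype {B = family t interval} (λ _ → part) (λ _ _ → refl)
    ⨟ extensional (component j) (λ _ f → f j) (component-lookup {A = interval} j)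
    ⨟ retype (λ _ I → Interval.lo I , Interval.hi I) (λ _ _ → refl)

  lo hi : Fin t → vertex ⟶ integer
  lo j = endpoints j ⨟ fst
  hi j = endpoints j ⨟ snd

  -- The thresholds come from the j-th intervals and are compared with l-th ones.
  fromLeft fromRight : Fin t → Fin t → Slot
  fromLeft j l = record
    { below      = ⟨ fst ⨟ lo j , snd ⨟ lo j ⟩ ⨟ atMostᵗ
    ; above      = ⟨ fst ⨟ lo j , snd ⨟ hi l ⟩ ⨟ atMostᵗ
    ; total      = λ i u v → ≤ℤᵇ-total (fun (lo j) i u) (fun (lo j) i v)
    ; transitive = λ i {u} {v} {w} → ≤ℤᵇ-trans (fun (lo j) i u) (fun (lo j) i v) (fun (lo j) i w)
    ; above-mono = λ i {u} {v} {w} → ≤ℤᵇ-trans (fun (lo j) i u) (fun (lo j) i v) (fun (hi l) i w)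
    }
  fromRight j l = record
    { below      = ⟨ snd ⨟ hi j , fst ⨟ hi j ⟩ ⨟ atMostᵗ
    ; above      = ⟨ snd ⨟ lo l , fst ⨟ hi j ⟩ ⨟ atMostᵗ
    ; total      = λ i u v → ≤ℤᵇ-total (fun (hi j) i v) (fun (hi j) i u)
    ; transitive = λ i {u} {v} {w} p q → ≤ℤᵇ-trans (fun (hi j) i w) (fun (hi j) i v) (fun (hi j) i u) q p
    ; above-mono = λ i {u} {v} {w} p q → ≤ℤᵇ-trans (fun (lo l) i w) (fun (hi j) i v) (fun (hi j) i u) q p
    }

  notLater-spec : ∀ i u v → T (fun V.notLaterᵗ i (u , v)) ⇔ toℕ u ≤ toℕ v
  notLater-spec i u v = mk⇔
    (λ p → ℕ.≮⇒≥ (not-elim (toℕ v <ᵇ toℕ u) p ∘ ℕ.<⇒<ᵇ))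
    (λ u≤v → not-intro (toℕ v <ᵇ toℕ u) (ℕ.≤⇒≯ u≤v ∘ ℕ.<ᵇ⇒< (toℕ v) (toℕ u)))

  notLater-total : ∀ i u v → T (fun V.notLaterᵗ i (u , v)) ⊎ T (fun V.notLaterᵗ i (v , u))
  notLater-total i u v = Sum.map (from (notLater-spec i u v)) (from (notLater-spec i v u))
    (ℕ.≤-total (toℕ u) (toℕ v))

  notLater-trans : ∀ i u v w → T (fun V.notLaterᵗ i (u , v)) → T (fun V.notLaterᵗ i (v , w)) →
    T (fun V.notLaterᵗ i (u , w))
  notLater-trans i u v w p q = from (notLater-spec i u w)
    (ℕ.≤-trans (to (notLater-spec i u v) p) (to (notLater-spec i v w) q))

  -- Vertices with the same intervals may differ in being marked, hence the
  -- comparison of the vertices themselves.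
  fromBefore fromAfter : Slot
  fromBefore = record
    { below      = V.notLaterᵗ
    ; above      = V.notLaterᵗ
    ; total      = notLater-total
    ; transitive = λ i {u} {v} {w} → notLater-trans i u v w
    ; above-mono = λ i {u} {v} {w} → notLater-trans i u v w
    }
  fromAfter = record
    { below      = ⟨ snd , fst ⟩ ⨟ V.notLaterᵗ
    ; above      = ⟨ snd , fst ⟩ ⨟ V.notLaterᵗ
    ; total      = λ i u v → notLater-total i v u
    ; transitive = λ i {u} {v} {w} p q → notLater-trans i w v u q p
    ; above-mono = λ i {u} {v} {w} p q → notLater-trans i w v u q p
    }

  intervalSlots : List Slot
  intervalSlots = concatMap
    (λ j → concatMap (λ l → fromLeft j l ∷ fromRight j l ∷ []) (allFin t)) (allFin t)

  -- There are 2t² + 2 slots, a constant for fixed t; with the two test entries the clique size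
  -- becomes (k + 1) to the power 2t² + 4.
  allSlots : List Slot
  allSlots = fromBefore ∷ fromAfter ∷ intervalSlots

  ∈-intervalSlots : ∀ j l {s} → s ∈ˡ fromLeft j l ∷ fromRight j l ∷ [] → s ∈ˡ intervalSlots
  ∈-intervalSlots j l s∈ = ∈-concatMap⁺ _ (Any.map (λ { refl →
    ∈-concatMap⁺ _ (Any.map (λ { refl → s∈ }) (∈-allFin l)) }) (∈-allFin j))

  -- Closed intervals meet iff each begins no later than the other ends. These two comparisons are
  -- what the slots record, `fromRight` with the line read from right to left.
  meetᵗ : Fin t → Fin t → vertex ×ᵗ vertex ⟶ bool
  meetᵗ j l = Slot.above (fromLeft j l) ∧ᵗ Slot.above (fromRight j l)

  meetsᵗ : Fin t → vertex ×ᵗ vertex ⟶ bool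
  meetsᵗ j = anyFin t (meetᵗ j)

  intersectᵗ : vertex ×ᵗ vertex ⟶ bool
  intersectᵗ = anyFin t meetsᵗ

  meet-spec : ∀ i d v j l → T (fun (meetᵗ j l) i (d , v)) ⇔
    (∃[ q ] q ∈ᴵ part (rep i d) j × q ∈ᴵ part (rep i v) l)
  meet-spec i d v j l = mk⇔
    (λ p → let p₁ , p₂ = to spec p
               q₁ = fromℤ-mono (≤ℤᵇ-sound I.lo J.hi p₁)
               q₂ = fromℤ-mono (≤ℤᵇ-sound J.lo I.hi p₂)
           in fromℤ I.lo ℚ.⊔ fromℤ J.lo ,
              (ℚ.p≤p⊔q _ _ , ℚ.⊔-lub (fromℤ-mono I.lo≤hi) q₂) ,
              (ℚ.p≤q⊔p _ _ , ℚ.⊔-lub q₁ (fromℤ-mono J.lo≤hi)))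
    (λ (q , (l≤q , q≤h) , (l′≤q , q≤h′)) → from spec
      ( ≤ℤᵇ-complete {I.lo} {J.hi} (fromℤ-cancel (ℚ.≤-trans l≤q q≤h′))
      , ≤ℤᵇ-complete {J.lo} {I.hi} (fromℤ-cancel (ℚ.≤-trans l′≤q q≤h))))
    where
    module I = Interval (part (rep i d) j)
    module J = Interval (part (rep i v) l)
    spec = ∧ᵗ-spec (Slot.above (fromLeft j l)) (Slot.above (fromRight j l)) i (d , v)

  intersect-spec : ∀ i d v → T (fun intersectᵗ i (d , v)) ⇔ Intersect (rep i v) (rep i d)
  intersect-spec i d v = mk⇔ (λ p → meets (to (anyFin-spec t meetsᵗ i (d , v)) p))
    (λ (q , (l , q∈v) , (j , q∈d)) → from (anyFin-spec t meetsᵗ i (d , v))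
      (j , from (anyFin-spec t (meetᵗ j) i (d , v)) (l , from (meet-spec i d v j l) (q , q∈d , q∈v))))
    where
    common : ∀ j l → (∃[ q ] q ∈ᴵ part (rep i d) j × q ∈ᴵ part (rep i v) l) →
      Intersect (rep i v) (rep i d)
    common j l (q , q∈d , q∈v) = q , (l , q∈v) , (j , q∈d)
    meet : ∀ j → (∃[ l ] T (fun (meetᵗ j l) i (d , v))) → Intersect (rep i v) (rep i d)
    meet j (l , p) = common j l (to (meet-spec i d v j l) p)
    meets : (∃[ j ] T (fun (meetsᵗ j) i (d , v))) → Intersect (rep i v) (rep i d)
    meets (j , p) = meet j (to (anyFin-spec t (meetᵗ j) i (d , v)) p)

  anyFin-cong : ∀ m (f : Fin m → Γ ⟶ bool) i γ γ′ →
    (∀ j → fun (f j) i γ ≡ fun (f j) i γ′) → fun (anyFin m f) i γ ≡ fun (anyFin m f) i γ′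
  anyFin-cong zero    f i γ γ′ eq = refl
  anyFin-cong (suc m) f i γ γ′ eq = cong₂ _∨_ (eq zero) (anyFin-cong m (f ∘ suc) i γ γ′ (eq ∘ suc))

  module _ (i : Input) (d v v′ : Fin (order i))
    (same : ∀ {s} → s ∈ˡ allSlots → fun (Slot.above s) i (d , v) ≡ fun (Slot.above s) i (d , v′)) where

    same-intersect : fun intersectᵗ i (d , v) ≡ fun intersectᵗ i (d , v′)
    same-intersect = anyFin-cong t meetsᵗ i (d , v) (d , v′) λ j →
      anyFin-cong t (meetᵗ j) i (d , v) (d , v′) λ l → cong₂ _∧_
        (same (there (there (∈-intervalSlots j l (here refl)))))
        (same (there (there (∈-intervalSlots j l (there (here refl))))))

    -- Equality with `d` amounts to two comparisons of positions, one recorded by `fromBefore`, the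
    -- other by `fromAfter`.
    same-≡ : does (v ≟ d) ≡ does (v′ ≟ d)
    same-≡ = T-ext (does (v ≟ d)) (does (v′ ≟ d))
      (λ p → does-complete (v′ ≟ d) (transfer v v′ (sym ≤d) (sym d≤) (does-sound (v ≟ d) p)))
      (λ p → does-complete (v ≟ d) (transfer v′ v ≤d d≤ (does-sound (v′ ≟ d) p)))
      where
      ≤d : fun V.notLaterᵗ i (d , v) ≡ fun V.notLaterᵗ i (d , v′)
      ≤d = same (here refl)
      d≤ : fun V.notLaterᵗ i (v , d) ≡ fun V.notLaterᵗ i (v′ , d)
      d≤ = same (there (here refl))
      transfer : ∀ v v′ → fun V.notLaterᵗ i (d , v′) ≡ fun V.notLaterᵗ i (d , v) →
        fun V.notLaterᵗ i (v′ , d) ≡ fun V.notLaterᵗ i (v , d) → v ≡ d → v′ ≡ d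
      transfer v v′ eq eq′ refl = toℕ-injective (ℕ.≤-antisym
        (to (notLater-spec i v′ d) (subst T (sym eq′) (from (notLater-spec i d d) ℕ.≤-refl)))
        (to (notLater-spec i d v′) (subst T (sym eq) (from (notLater-spec i d d) ℕ.≤-refl))))

  different : vertex ×ᵗ vertex ⟶ bool
  different = notᵗ V.sameᵗ

  different-spec : ∀ i u v → T (fun different i (u , v)) ⇔ u ≢ v
  different-spec i u v = mk⇔
    (λ p → not-elim (does (u ≟ v)) p ∘ does-complete (u ≟ v))
    (λ u≢v → not-intro (does (u ≟ v)) (u≢v ∘ does-sound (u ≟ v)))

  intervalGraphs coIntervalGraphs : GraphKind
  intervalGraphs = record
    { toGraph       = intersectionGraph
    ; adjacent      = different ∧ᵗ (⟨ snd , fst ⟩ ⨟ intersectᵗ)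
    ; adjacent-spec = λ i u v → mk⇔
        (λ p → let p₁ , p₂ = to (∧ᵗ-spec different (⟨ snd , fst ⟩ ⨟ intersectᵗ) i (u , v)) p
               in does-complete (¬? (u ≟ v) ×-dec intersect? (rep i u) (rep i v))
                    (to (different-spec i u v) p₁ , to (intersect-spec i v u) p₂))
        (λ p → let u≢v , meet = does-sound (¬? (u ≟ v) ×-dec intersect? (rep i u) (rep i v)) p
               in from (∧ᵗ-spec different (⟨ snd , fst ⟩ ⨟ intersectᵗ) i (u , v))
                    (from (different-spec i u v) u≢v , from (intersect-spec i v u) meet))
    ; slots         = allSlots
    ; determined    = λ i d v v′ same → subst T (cong₂ (λ a b → a ∨ not a ∧ b)
        (same-≡ i d v v′ same) (same-intersect i d v v′ same))
    }
  coIntervalGraphs = record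
    { toGraph       = λ F → complement (intersectionGraph F)
    ; adjacent      = different ∧ᵗ notᵗ (⟨ snd , fst ⟩ ⨟ intersectᵗ)
    ; adjacent-spec = λ i u v → mk⇔
        (λ p → let p₁ , p₂ = to (∧ᵗ-spec different (notᵗ (⟨ snd , fst ⟩ ⨟ intersectᵗ)) i (u , v)) p
               in does-complete (co? i u v)
                    ( to (different-spec i u v) p₁
                    , λ adj → not-elim (fun intersectᵗ i (v , u)) p₂ (from (intersect-spec i v u)
                        (proj₂ (does-sound (¬? (u ≟ v) ×-dec intersect? (rep i u) (rep i v)) adj)))))
        (λ p → let u≢v , apart = does-sound (co? i u v) p
               in from (∧ᵗ-spec different (notᵗ (⟨ snd , fst ⟩ ⨟ intersectᵗ)) i (u , v))
                    ( from (different-spec i u v) u≢v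
                    , not-intro (fun intersectᵗ i (v , u)) λ meet → apart
                        (does-complete (¬? (u ≟ v) ×-dec intersect? (rep i u) (rep i v))
                          (u≢v , to (intersect-spec i v u) meet))))
    ; slots         = allSlots
    -- As for interval graphs, domination by `d` is a Boolean function of two bits, being `d` and
    -- intersecting `d`. Complementing only negates the second, so the same slots serve.
    ; determined    = λ i d v v′ same → subst T (cong₂ (λ a b → a ∨ not a ∧ not b)
        (same-≡ i d v v′ same) (same-intersect i d v v′ same))
    }
    where
    co? : ∀ i u v → Dec (u ≢ v × ¬ Graph._~_ (intersectionGraph (rep i)) u v)
    co? i u v = ¬? (u ≟ v) ×-dec ¬? (T? (Graph.adj (intersectionGraph (rep i)) u v))

  -- The tests for the four properties

  module Tests (kind : GraphKind) where
    open GraphKind kind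

    listing : ∀ {k n} {D : Subset n} → ∣ D ∣ ≡ k → ∃[ d ] _Lists_ {k} d D
    listing {D = D} refl = elements D , elements-lists D

    plain : Test kind IsDominating
    plain = record
      { check    = trueᵗ
      ; complete = λ i ∣D∣≡k dominating →
          let d , d-lists = listing ∣D∣≡k in d , d-lists , dominating , λ _ _ → zero , _
      ; sound    = λ i d-lists dominating _ → dominating
      }

    adjacentMarks : (pos ×ᵗ vertex) ×ᵗ ((pos ×ᵗ vertex) ×ᵗ atom) ⟶ bool
    adjacentMarks = ⟨ fst ⨟ snd , snd ⨟ fst ⨟ snd ⟩ ⨟ adjacent

    independent : Test kind IsIndependentDominating
    independent = record
      { check    = notᵗ adjacentMarks
      ; complete = λ i ∣D∣≡k (dominating , indep) →
          let d , d-lists = listing ∣D∣≡k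
          in d , d-lists , dominating , λ a b → zero ,
             not-intro (fun adjacent i (d a , d b))
               (indep (member d-lists a) (member d-lists b) ∘ to (adjacent-spec i (d a) (d b)))
      ; sound    = λ i {d} d-lists dominating passes → dominating , λ u∈D v∈D u~v →
          let a , da≡u = exhaustive d-lists u∈D
              b , db≡v = exhaustive d-lists v∈D
          in not-elim (fun adjacent i (d a , d b)) (proj₂ (passes a b))
               (from (adjacent-spec i (d a) (d b))
                 (subst T (sym (cong₂ (Graph.adj (graph i)) da≡u db≡v)) u~v))
      }

    clique : Test kind IsDominatingClique
    clique = record
      { check    = (⟨ fst ⨟ fst , snd ⨟ fst ⨟ fst ⟩ ⨟ P.sameᵗ) ∨ᵗ adjacentMarks
      ; complete = λ i ∣D∣≡k (dominating , isClique) →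
          let d , d-lists = listing ∣D∣≡k
          in d , d-lists , dominating , λ a b → zero , joined i d a b
               (λ da≢db → isClique (member d-lists a) (member d-lists b) da≢db)
               (injective d-lists)
      ; sound    = λ i {d} d-lists dominating passes → dominating , λ u∈D v∈D u≢v →
          let a , da≡u = exhaustive d-lists u∈D
              b , db≡v = exhaustive d-lists v∈D
          in [ (λ p → contradiction (trans (sym da≡u) (trans (cong d (does-sound (a ≟ b) p)) db≡v)) u≢v)
             , (λ p → subst T (cong₂ (Graph.adj (graph i)) da≡u db≡v)
                        (to (adjacent-spec i (d a) (d b)) p))
             ]′ (to (T-∨ {does (a ≟ b)}) (proj₂ (passes a b)))
      }
      where
      joined : ∀ i (d : Fin (parameter i) → Fin (order i)) a b →
        (d a ≢ d b → Graph._~_ (graph i) (d a) (d b)) → Injective _≡_ _≡_ d →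
        T (does (a ≟ b) ∨ fun adjacent i (d a , d b))
      joined i d a b adj d-inj with a ≟ b
      ... | yes _  = _
      ... | no a≢b = from (adjacent-spec i (d a) (d b)) (adj (a≢b ∘ d-inj))

    -- The third vertex is the later neighbour that `Grown` demands of the second; the first one
    -- only witnesses that the second is not last. If a neighbour is demanded, `nothing` fails.
    connected : Test kind IsConnectedDominating
    connected = record
      { check    = notᵗ later ∨ᵗ (⟨ snd ⨟ fst , snd ⨟ snd ⟩ ⨟ caseMaybe falseᵗ attached)
      ; complete = λ i ∣D∣≡k (dominating , conn) →
          let d , d-lists , grown = connected⇒grown (graph i) ∣D∣≡k conn
          in d , d-lists , dominating , passes i d grown
      ; sound    = λ i {d} d-lists dominating passes →
          dominating , grown⇒connected (graph i) d-lists (grown i d passes)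
      }
      where
      later : (pos ×ᵗ vertex) ×ᵗ ((pos ×ᵗ vertex) ×ᵗ atom) ⟶ bool
      later = ⟨ fst ⨟ fst , snd ⨟ fst ⨟ fst ⟩ ⨟ P.laterᵗ

      isLater : (pos ×ᵗ vertex) ×ᵗ (pos ×ᵗ vertex) ⟶ bool
      isLater = ⟨ snd ⨟ fst , fst ⨟ fst ⟩ ⨟ P.laterᵗ

      isAdjacent : (pos ×ᵗ vertex) ×ᵗ (pos ×ᵗ vertex) ⟶ bool
      isAdjacent = ⟨ snd ⨟ snd , fst ⨟ snd ⟩ ⨟ adjacent

      attached : (pos ×ᵗ vertex) ×ᵗ (pos ×ᵗ vertex) ⟶ bool
      attached = isLater ∧ᵗ isAdjacent

      module _ (i : Input) (d : Fin (parameter i) → Fin (order i)) where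

        attached-spec : ∀ b c → T (fun attached i ((b , d b) , (c , d c))) ⇔
          (toℕ b < toℕ c × Graph._~_ (graph i) (d c) (d b))
        attached-spec b c = mk⇔
          (λ p → let p₁ , p₂ = to spec p
                 in ℕ.<ᵇ⇒< (toℕ b) (toℕ c) p₁ , to (adjacent-spec i (d c) (d b)) p₂)
          (λ (b<c , c~b) → from spec (ℕ.<⇒<ᵇ b<c , from (adjacent-spec i (d c) (d b)) c~b))
          where
          spec = ∧ᵗ-spec isLater isAdjacent i ((b , d b) , (c , d c))

        passes : Grown (graph i) d → ∀ a b → ∃[ c ]
          T (not (toℕ b <ᵇ toℕ a) ∨ maybe (λ m → fun attached i ((b , d b) , m)) false (at d c))
        passes grown a b with T? (toℕ b <ᵇ toℕ a)
        ... | no  b≮a = zero , ⇒-intro (toℕ b <ᵇ toℕ a) (⊥-elim ∘ b≮a)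
        ... | yes b<a =
          let c , b<c , c~b = grown a b (ℕ.<ᵇ⇒< (toℕ b) (toℕ a) b<a)
          in suc c , ⇒-intro (toℕ b <ᵇ toℕ a) λ _ → from (attached-spec b c) (b<c , c~b)

        grown : (∀ a b → ∃[ c ]
          T (not (toℕ b <ᵇ toℕ a) ∨ maybe (λ m → fun attached i ((b , d b) , m)) false (at d c))) →
          Grown (graph i) d
        grown passes a b b<a with passes a b
        ... | zero  , p = ⊥-elim (⇒-elim (toℕ b <ᵇ toℕ a) p (ℕ.<⇒<ᵇ b<a))
        ... | suc c , p = c , to (attached-spec b c) (⇒-elim (toℕ b <ᵇ toℕ a) p (ℕ.<⇒<ᵇ b<a))

theorem6 : (t : ℕ) → 2 ≤ t →
    (IsDominating onIntervalGraphs t ∈W[1])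
    × (IsConnectedDominating onIntervalGraphs t ∈W[1])
    × (IsIndependentDominating onIntervalGraphs t ∈W[1])
    × (IsDominatingClique onIntervalGraphs t ∈W[1])
    × (IsDominating onCoIntervalGraphs t ∈W[1])
    × (IsConnectedDominating onCoIntervalGraphs t ∈W[1])
    × (IsIndependentDominating onCoIntervalGraphs t ∈W[1])
    × (IsDominatingClique onCoIntervalGraphs t ∈W[1])
theorem6 t _ =
    reduction intervalGraphs IsDominating I.plain
  , reduction intervalGraphs IsConnectedDominating I.connected
  , reduction intervalGraphs IsIndependentDominating I.independent
  , reduction intervalGraphs IsDominatingClique I.clique
  , reduction coIntervalGraphs IsDominating C.plain
  , reduction coIntervalGraphs IsConnectedDominating C.connected
  , reduction coIntervalGraphs IsIndependentDominating C.independent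
  , reduction coIntervalGraphs IsDominatingClique C.clique
  where
  open Reduction t using (reduction)
  open Intervals t
  module I = Tests intervalGraphs
  module C = Tests coIntervalGraphs
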